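{- Every $3$-regular graph $G$ having a MED decomposition is $(7,2)$-edge-choosable.
   Context: A double-star is a $6$-vertex tree having two adjacent vertices of degree $3$. A subgraph $F$ of $G$ consists of independent double-stars if its components are pairwise vertex-disjoint double-stars and the set of all leaves of components of $F$ is an independent set of vertices in $G$. A MED decomposition of $G$ is a partition of $E(G)$ into subgraphs $G_1,G_2,G_3$ where $G_1$ is a matching, every component of $G_2$ is an even cycle, and $G_3$ consists of independent double-stars. A graph is $(r,s)$-edge-choosable if for every assignment of lists of size $r$ to its edges, one can choose $s$ colors from each edge's list so that incident edges receive disjoint sets. -}

module Defs where

open import Data.Nat using (ℕ; zero; suc; _+_; _*_; _<_)
open import Data.Nat.DivMod using (_mod_)
open import Data.Bool using (Bool; true; false; T; if_then_else_)
open import Data.Fin using (Fin; toℕ) renaming (zero to #0; suc to fs)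
open import Data.List using (List; map; allFin)
open import Data.Nat.ListAction using (sum)
open import Data.Product using (Σ; ∃; ∃-syntax; _×_; _,_)
open import Data.Sum using (_⊎_)
open import Relation.Binary.PropositionalEquality using (_≡_; _≢_)
open import Function.Definitions using (Injective)

record Graph (n : ℕ) : Set where
  field
    adj    : Fin n → Fin n → Bool
    sym    : ∀ u v → adj u v ≡ adj v u
    irrefl : ∀ u → adj u u ≡ false
open Graph public

degree : {n : ℕ} → Graph n → Fin n → ℕ
degree {n} G u = sum (map (λ v → if adj G u v then 1 else 0) (allFin n))

Regular : {n : ℕ} → ℕ → Graph n → Set
Regular k G = ∀ u → degree G u ≡ k

-- An edge {x,y} is stored once, with endpoints x < y.
record Edge {n : ℕ} (G : Graph n) : Set where
  constructor edge
  field
    x   : Fin n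
    y   : Fin n
    x<y : toℕ x < toℕ y
    xy  : T (adj G x y)
open Edge public

Joins : {n : ℕ} {G : Graph n} → Edge G → Fin n → Fin n → Set
Joins e a b = (x e ≡ a × y e ≡ b) ⊎ (x e ≡ b × y e ≡ a)

Incident : {n : ℕ} {G : Graph n} → Edge G → Edge G → Set
Incident e f =
  ((x e , y e) ≢ (x f , y f)) ×
  (x e ≡ x f ⊎ x e ≡ y f ⊎ y e ≡ x f ⊎ y e ≡ y f)

-- Even cycles: a cycle of even length 4 + 2j, given by its cyclic
-- sequence of distinct vertices, consecutive ones adjacent in G.

cycLen : ℕ → ℕ
cycLen j = 4 + 2 * j

next : (j : ℕ) → Fin (cycLen j) → Fin (cycLen j)
next j t = suc (toℕ t) mod cycLen j

record EvenCycle {n : ℕ} (G : Graph n) : Set where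
  field
    half  : ℕ
    vert  : Fin (cycLen half) → Fin n
    vinj  : Injective _≡_ _≡_ vert
    vadj  : ∀ t → T (adj G (vert t) (vert (next half t)))
open EvenCycle public

OnCycle : {n : ℕ} {G : Graph n} → EvenCycle G → Edge G → Set
OnCycle C e = ∃[ t ] Joins e (vert C t) (vert C (next (half C) t))

-- Double-stars: vertex 0 and 1 are the two adjacent centres, vertices
-- 2,3 are the leaves at centre 0, vertices 4,5 the leaves at centre 1.

dsEdge : Fin 5 → Fin 6 × Fin 6
dsEdge #0 = (#0 , fs #0)
dsEdge (fs #0) = (#0 , fs (fs #0))
dsEdge (fs (fs #0)) = (#0 , fs (fs (fs #0)))
dsEdge (fs (fs (fs #0))) = (fs #0 , fs (fs (fs (fs #0))))
dsEdge (fs (fs (fs (fs #0)))) = (fs #0 , fs (fs (fs (fs (fs #0)))))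

leaf : Fin 4 → Fin 6
leaf t = fs (fs t)

record DoubleStar {n : ℕ} (G : Graph n) : Set where
  field
    dv   : Fin 6 → Fin n
    dinj : Injective _≡_ _≡_ dv
    dadj : ∀ k → let (p , q) = dsEdge k in T (adj G (dv p) (dv q))
open DoubleStar public

OnDoubleStar : {n : ℕ} {G : Graph n} → DoubleStar G → Edge G → Set
OnDoubleStar D e = ∃[ k ] (let (p , q) = dsEdge k in Joins e (dv D p) (dv D q))

-- MED decomposition: every edge gets a part 0 (G₁), 1 (G₂) or 2 (G₃).

part1 part2 : Fin 3
part1 = fs #0
part2 = fs (fs #0)

IsMatchingPart : {n : ℕ} {G : Graph n} → (Edge G → Fin 3) → Set
IsMatchingPart {G = G} π =
  ∀ (e f : Edge G) → π e ≡ #0 → π f ≡ #0 → Incident e f → Data.Empty.⊥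
  where import Data.Empty

-- every component of G₂ is an even cycle: G₂ is the union of a family
-- of pairwise vertex-disjoint even cycles of G
IsEvenCyclesPart : {n : ℕ} {G : Graph n} → (Edge G → Fin 3) → Set
IsEvenCyclesPart {G = G} π =
  Σ ℕ λ k → Σ (Fin k → EvenCycle G) λ C →
    (∀ i j s t → i ≢ j → vert (C i) s ≢ vert (C j) t) ×
    (∀ e → (π e ≡ part1) → ∃[ i ] OnCycle (C i) e) ×
    (∀ e i → OnCycle (C i) e → π e ≡ part1)

IsIndepDoubleStarsPart : {n : ℕ} {G : Graph n} → (Edge G → Fin 3) → Set
IsIndepDoubleStarsPart {G = G} π =
  Σ ℕ λ k → Σ (Fin k → DoubleStar G) λ D →
    (∀ i j s t → i ≢ j → dv (D i) s ≢ dv (D j) t) ×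
    (∀ i j s t → adj G (dv (D i) (leaf s)) (dv (D j) (leaf t)) ≡ false) ×
    (∀ e → (π e ≡ part2) → ∃[ i ] OnDoubleStar (D i) e) ×
    (∀ e i → OnDoubleStar (D i) e → π e ≡ part2)

HasMEDDecomposition : {n : ℕ} → Graph n → Set
HasMEDDecomposition G =
  Σ (Edge G → Fin 3) λ π →
    IsMatchingPart π × IsEvenCyclesPart π × IsIndepDoubleStarsPart π

-- (r,s)-edge-choosability; colours are natural numbers, a list of size r
-- is an injective map Fin r → ℕ, a chosen s-set an injective Fin s → ℕ.

EdgeChoosable : {n : ℕ} → ℕ → ℕ → Graph n → Set
EdgeChoosable r s G =
  ∀ (L : Edge G → Fin r → ℕ) → (∀ e → Injective _≡_ _≡_ (L e)) →
  Σ (Edge G → Fin s → ℕ) λ C →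
    (∀ e → Injective _≡_ _≡_ (C e)) ×
    (∀ e j → ∃[ i ] C e j ≡ L e i) ×
    (∀ e f → Incident e f → ∀ j k → C e j ≢ C f k)

{-# OPTIONS --safe #-}
module Submission where

-- Orient every cycle of G₂.  Let A v be the list of the cycle edge leaving v and L v that of the edge at v
-- outside G₂.  If the pairs chosen outside G₂ cost every A v at most three colours, four remain, and an even
-- cycle with lists of size four has disjoint pairs (Galvin's kernel argument, one colour at a time).
--
-- A matching edge has one colour for each of its ends.  Going backwards along a cycle, v copies the colour
-- of its successor or takes a colour outside A v; one of the two is always possible, as L v and A v have equal
-- size.  One may start at any v that has a colour outside A v, or at v copying the colour that the matching
-- edge of its successor has already received at its other end.  A leaf whose sibling is already coloured is
-- "cut": it starts afresh with any colour different from its sibling's, and its outgoing edge is served at the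
-- end by its second colour.  By independence the successor of a leaf is on a matching edge; once both colours
-- of that edge are known there are two choices for the second colour, and one avoids the sibling.  The first
-- colour of a cut leaf is chosen so that two colours remain for the central edge of the star.
-- What cannot be coloured in this way is a union of cycles on which all lists agree, closed under siblings
-- and partners; there all matching edges receive the two least colours of the list.

open import Data.Bool using (Bool; true; false; not; if_then_else_; T)
open import Data.Bool.Properties using (T?; T-irrelevant; not-involutive)
open import Data.Empty using (⊥; ⊥-elim)
open import Data.Fin using (Fin; toℕ; opposite) renaming (zero to #0; suc to fs)
import Data.Fin.Properties as Finₚ
open import Data.List using (List; []; _∷_; _++_; length; filter; concatMap; allFin; tabulate; upTo; map)
open import Data.List.Membership.Propositional using (_∈_; _∉_; find; lose)
open import Data.List.Membership.Propositional.Properties using (∈-∃++; ∈-++⁺ˡ; ∈-++⁺ʳ; ∈-++⁻; ∈-filter⁺; ∈-filter⁻; ∈-concatMap⁺; ∈-allFin; ∈-tabulate⁻)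
open import Data.List.Properties using (length-++; filter-notAll; length-tabulate)
open import Data.List.Relation.Binary.Subset.Propositional using (_⊆_)
open import Data.List.Relation.Unary.All as All using (All; []; _∷_)
open import Data.List.Relation.Unary.Any as Any using (here; there)
open import Data.List.Relation.Unary.Unique.Propositional using (Unique; []; _∷_)
import Data.List.Relation.Unary.Unique.Propositional.Properties as Uniqueₚ
open import Data.Maybe using (Maybe; just; nothing; fromMaybe)
open import Data.Maybe.Properties using (just-injective)
open import Data.Nat using (ℕ; zero; suc; _+_; _∸_; _≤_; _<_; z≤n; s≤s; _<?_)
open import Data.Nat.DivMod using (_%_; m<n⇒m%n≡m; n%n≡0)
open import Data.Nat.ListAction using (sum)
open import Data.Nat.Properties as ℕₚ using (≤-refl; ≤-trans; ≤-reflexive)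
open import Data.Product using (Σ; ∃-syntax; _×_; _,_; proj₁; proj₂)
open import Data.Sum using (_⊎_; inj₁; inj₂)
open import Defs
open import Function using (_∘_)
open import Function.Definitions using (Injective)
open import Relation.Binary.Definitions using (DecidableEquality; tri<; tri≈; tri>)
open import Relation.Binary.PropositionalEquality using (_≡_; _≢_; refl; trans; cong; cong₂; subst; subst₂) renaming (sym to ≡-sym)
open import Relation.Nullary using (¬_; Dec; yes; no; does)
open import Relation.Nullary.Decidable using (¬?; _×-dec_; _⊎-dec_; _→-dec_; from-yes; map′; dec-true)

open import Data.List.Membership.DecPropositional ℕₚ._≟_ using (_∈?_)

does⇒ : ∀ {A : Set} (a? : Dec A) → does a? ≡ true → A
does⇒ (yes a) _ = a

-- Counting in duplicate-free lists

pigeonhole : ∀ {A : Set} {xs ys : List A} → Unique xs → xs ⊆ ys → length xs ≤ length ys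
pigeonhole [] sub = z≤n
pigeonhole {xs = x ∷ xs} (x≢ ∷ u) sub with ∈-∃++ (sub (here refl))
... | as , bs , refl = ≤-trans (s≤s (pigeonhole u sub′)) (≤-reflexive len)
  where
  sub′ : xs ⊆ as ++ bs
  sub′ z∈ with ∈-++⁻ as (sub (there z∈))
  ... | inj₁ z∈as = ∈-++⁺ˡ z∈as
  ... | inj₂ (here refl) = ⊥-elim (All.lookup x≢ z∈ refl)
  ... | inj₂ (there z∈bs) = ∈-++⁺ʳ as z∈bs
  len : suc (length (as ++ bs)) ≡ length (as ++ x ∷ bs)
  len = trans (cong suc (length-++ as))
          (trans (≡-sym (ℕₚ.+-suc (length as) (length bs))) (≡-sym (length-++ as)))

avoiding : ∀ {A : Set} → DecidableEquality A → {xs ys : List A} → Unique xs →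
           length ys < length xs → ∃[ x ] (x ∈ xs × x ∉ ys)
avoiding _≟_ {xs} {ys} u lt with Any.any? (λ x → ¬? (Any.any? (x ≟_) ys)) xs
... | yes a = let x , x∈ , x∉ = find a in x , x∈ , x∉
... | no ¬a = ⊥-elim (ℕₚ.<⇒≱ lt (pigeonhole u sub))
  where
  sub : xs ⊆ ys
  sub {z} z∈ with Any.any? (z ≟_) ys
  ... | yes z∈ys = z∈ys
  ... | no z∉ys = ⊥-elim (¬a (lose z∈ z∉ys))

avoidingℕ : ∀ {xs ys : List ℕ} → Unique xs → length ys < length xs → ∃[ x ] (x ∈ xs × x ∉ ys)
avoidingℕ = avoiding ℕₚ._≟_

_∖_ : List ℕ → List ℕ → List ℕ
xs ∖ ys = filter (λ z → ¬? (z ∈? ys)) xs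

∈-∖⁻ : ∀ {xs ys z} → z ∈ xs ∖ ys → z ∈ xs × z ∉ ys
∈-∖⁻ {ys = ys} = ∈-filter⁻ (λ z → ¬? (z ∈? ys))

∈-∖⁺ : ∀ {xs ys z} → z ∈ xs → z ∉ ys → z ∈ xs ∖ ys
∈-∖⁺ {ys = ys} = ∈-filter⁺ (λ z → ¬? (z ∈? ys))

∖-unique : ∀ {xs ys} → Unique xs → Unique (xs ∖ ys)
∖-unique {ys = ys} = Uniqueₚ.filter⁺ (λ z → ¬? (z ∈? ys))

-- Only the colours of `ys` that occur in `xs` have to be covered by `zs`. A colour repeated in `ys`
-- or absent from `xs` therefore costs nothing extra, which is how savings enter the count for the
-- cycle edges.
∖-length : ∀ {xs ys zs} → Unique xs → (∀ {z} → z ∈ xs → z ∈ ys → z ∈ zs) →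
           length xs ≤ length (xs ∖ ys) + length zs
∖-length {xs} {ys} {zs} u cov = ≤-trans (pigeonhole u sub) (≤-reflexive (length-++ (xs ∖ ys)))
  where
  sub : xs ⊆ (xs ∖ ys) ++ zs
  sub {z} z∈ with z ∈? ys
  ... | yes z∈ys = ∈-++⁺ʳ (xs ∖ ys) (cov z∈ z∈ys)
  ... | no z∉ys = ∈-++⁺ˡ (∈-∖⁺ z∈ z∉ys)

∖-single : ∀ {xs} a → a ∈ xs → length (xs ∖ (a ∷ [])) < length xs
∖-single {xs} a a∈ = filter-notAll _ xs (lose a∈ (λ a∉ → a∉ (here refl)))

Seven : List ℕ → Set
Seven xs = Unique xs × length xs ≡ 7

-- If some element of `ys` were missing from `xs`, deleting it from `ys` would leave seven elements
-- inside a list of at most six.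
⊆-reverse : ∀ {xs ys} → Seven xs → Seven ys → xs ⊆ ys → ys ⊆ xs
⊆-reverse {xs} {ys} (ux , lx) (uy , ly) sub {z} z∈ with z ∈? xs
... | yes z∈xs = z∈xs
... | no z∉xs = ⊥-elim (ℕₚ.<⇒≱ (∖-single z z∈)
        (≤-trans (≤-reflexive (trans ly (≡-sym lx))) (pigeonhole ux sub′)))
  where
  sub′ : xs ⊆ ys ∖ (z ∷ [])
  sub′ {w} w∈ = ∈-∖⁺ (sub w∈) (λ { (here refl) → z∉xs w∈ })

pick : ∀ {xs} ys → Seven xs → length ys < 7 → ∃[ x ] (x ∈ xs × x ∉ ys)
pick ys (u , l) lt = avoidingℕ {ys = ys} u (≤-trans lt (≤-reflexive (≡-sym l)))

-- At most five elements of ys are excluded besides f, so a 7-set cannot lie inside the exclusions.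
pick-near : ∀ {xs ys} f a b → Seven xs → Seven ys → a ≢ b →
            ∃[ t ] (t ∈ xs × t ≢ f × (a ∉ ys ⊎ b ∉ ys ⊎ t ∉ ys ⊎ t ≡ a ⊎ t ≡ b))
pick-near {xs} {ys} f a b sx sy a≢b with a ∈? ys | b ∈? ys
... | no a∉ | _ = let t , t∈ , t∉ = pick (f ∷ []) sx (s≤s (s≤s z≤n))
                  in t , t∈ , (λ e → t∉ (here e)) , inj₁ a∉
... | yes _ | no b∉ = let t , t∈ , t∉ = pick (f ∷ []) sx (s≤s (s≤s z≤n))
                      in t , t∈ , (λ e → t∉ (here e)) , inj₂ (inj₁ b∉)
... | yes a∈ | yes b∈ = t , t∈ , (λ e → t∉ (here e)) , inj₂ (inj₂ near)
  where
  rest : List ℕ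
  rest = (ys ∖ (a ∷ [])) ∖ (b ∷ [])
  short : suc (length rest) < 7
  short = ≤-trans (s≤s (∖-single b (∈-∖⁺ b∈ (λ { (here e) → a≢b (≡-sym e) }))))
            (≤-trans (∖-single a a∈) (≤-reflexive (proj₂ sy)))
  found = pick (f ∷ rest) sx short
  t = proj₁ found
  t∈ = proj₁ (proj₂ found)
  t∉ = proj₂ (proj₂ found)
  near : t ∉ ys ⊎ t ≡ a ⊎ t ≡ b
  near with t ∈? ys | t ℕₚ.≟ a | t ℕₚ.≟ b
  ... | no t∉ys | _ | _ = inj₁ t∉ys
  ... | yes _ | yes e | _ = inj₂ (inj₁ e)
  ... | yes _ | no _ | yes e = inj₂ (inj₂ e)
  ... | yes t∈ys | no t≢a | no t≢b =
    ⊥-elim (t∉ (there (∈-∖⁺ (∈-∖⁺ t∈ys (λ { (here e) → t≢a e })) (λ { (here e) → t≢b e }))))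

-- A canonical pair that depends only on the set of colours, not on the order of the list, so that
-- edges whose lists agree as sets select the same two colours.
record TwoLeast (xs : List ℕ) (a b : ℕ) : Set where
  field
    a∈   : a ∈ xs
    b∈   : b ∈ xs
    a≢b  : a ≢ b
    a-lb : ∀ {z} → z ∈ xs → a ≤ z
    b-lb : ∀ {z} → z ∈ xs → z ≢ a → b ≤ z

least : ∀ xs → 0 < length xs → ∃[ a ] (a ∈ xs × (∀ {z} → z ∈ xs → a ≤ z))
least (x ∷ []) _ = x , here refl , λ { (here refl) → ≤-refl }
least (x ∷ y ∷ xs) _ with least (y ∷ xs) (s≤s z≤n)
... | a , a∈ , lb with ℕₚ.≤-total x a
...   | inj₁ x≤a = x , here refl , λ { (here refl) → ≤-refl ; (there z∈) → ≤-trans x≤a (lb z∈) }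
...   | inj₂ a≤x = a , there a∈ , λ { (here refl) → a≤x ; (there z∈) → lb z∈ }

two-least : ∀ {xs} → Seven xs → ∃[ a ] ∃[ b ] TwoLeast xs a b
two-least {xs} (u , l) with least xs (≤-trans (s≤s z≤n) (≤-reflexive (≡-sym l)))
... | a , a∈ , a-lb with least (xs ∖ (a ∷ [])) pos
  where
  pos : 0 < length (xs ∖ (a ∷ []))
  pos = ℕₚ.+-cancelʳ-≤ 1 1 _ (≤-trans (s≤s (s≤s z≤n))
          (≤-trans (≤-reflexive (≡-sym l)) (∖-length {ys = a ∷ []} {zs = a ∷ []} u (λ _ z∈ → z∈))))
...   | b , b∈ , b-lb = a , b , record
        { a∈ = a∈ ; b∈ = proj₁ (∈-∖⁻ b∈) ; a≢b = λ e → proj₂ (∈-∖⁻ {xs = xs} b∈) (here (≡-sym e))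
        ; a-lb = a-lb ; b-lb = λ z∈ z≢a → b-lb (∈-∖⁺ z∈ (λ { (here e) → z≢a e })) }

two-least-unique : ∀ {xs ys a b c d} → xs ⊆ ys → ys ⊆ xs → TwoLeast xs a b → TwoLeast ys c d →
                   a ≡ c × b ≡ d
two-least-unique {a = a} {b} {c} {d} p q s t = a≡c , b≡d
  where
  module S = TwoLeast s
  module T = TwoLeast t
  a≡c : a ≡ c
  a≡c = ℕₚ.≤-antisym (S.a-lb (q T.a∈)) (T.a-lb (p S.a∈))
  b≡d : b ≡ d
  b≡d = ℕₚ.≤-antisym (S.b-lb (q T.b∈) (λ e → T.a≢b (trans (≡-sym a≡c) (≡-sym e))))
                     (T.b-lb (p S.b∈) (λ e → S.a≢b (trans a≡c (≡-sym e))))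

-- Saturating partial assignments

module _ {X : Set} where

  upd : ∀ {n} → (Fin n → Maybe X) → Fin n → X → Fin n → Maybe X
  upd σ v x u = if does (u Finₚ.≟ v) then just x else σ u

  -- The termination measure of `saturate`.
  blank : ∀ {n} → (Fin n → Maybe X) → ℕ
  blank {zero} σ = 0
  blank {suc n} σ with σ #0
  ... | nothing = suc (blank (σ ∘ fs))
  ... | just _ = blank (σ ∘ fs)

  blank-upd : ∀ {n} (σ : Fin n → Maybe X) v x → σ v ≡ nothing → blank (upd σ v x) < blank σ
  blank-upd {suc n} σ #0 x e with σ #0
  ... | nothing = ≤-refl
  blank-upd {suc n} σ (fs v) x e with σ #0
  ... | nothing = s≤s (blank-upd (σ ∘ fs) v x e)
  ... | just _ = blank-upd (σ ∘ fs) v x e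

  upd-ext : ∀ {n} (σ : Fin n → Maybe X) v x {u z} → σ v ≡ nothing → σ u ≡ just z → upd σ v x u ≡ just z
  upd-ext σ v x {u} e f with u Finₚ.≟ v
  ... | no _ = f
  ... | yes refl with trans (≡-sym e) f
  ...   | ()

  upd-inv : ∀ {n} (σ : Fin n → Maybe X) v x {u z} → upd σ v x u ≡ just z → (u ≡ v × x ≡ z) ⊎ σ u ≡ just z
  upd-inv σ v x {u} f with u Finₚ.≟ v
  ... | yes p = inj₁ (p , just-injective f)
  ... | no _ = inj₂ f

  search : ∀ {n} {P : Fin n → Set} {Q : Set} → (∀ v → P v ⊎ Q) → (∀ v → P v) ⊎ Q
  search {zero} f = inj₁ (λ ())
  search {suc n} f with f #0 | search (f ∘ fs)
  ... | inj₂ q | _ = inj₂ q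
  ... | inj₁ _ | inj₂ q = inj₂ q
  ... | inj₁ p | inj₁ ps = inj₁ (λ { #0 → p ; (fs v) → ps v })

  -- Every extension lowers `blank`, so greedy extension ends, and it ends only when no blank vertex
  -- can be extended. It serves both for kernels and for the colouring outside the cycles.
  saturate : ∀ {n} {Inv : (Fin n → Maybe X) → Set} {Stuck : (Fin n → Maybe X) → Fin n → Set} →
    (∀ σ v → Inv σ → σ v ≡ nothing → Stuck σ v ⊎ ∃[ x ] Inv (upd σ v x)) →
    ∀ σ → Inv σ → ∃[ τ ] (Inv τ × (∀ v → τ v ≡ nothing → Stuck τ v))
  saturate {n} {Inv} {Stuck} step σ i = go (suc (blank σ)) σ ≤-refl i
    where
    go : ∀ b σ → blank σ < b → Inv σ → ∃[ τ ] (Inv τ × (∀ v → τ v ≡ nothing → Stuck τ v))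
    go (suc b) σ (s≤s lt) i with search {P = λ v → σ v ≡ nothing → Stuck σ v} try
      where
      try : ∀ v → (σ v ≡ nothing → Stuck σ v) ⊎ ∃[ v ] (σ v ≡ nothing × ∃[ x ] Inv (upd σ v x))
      try v with σ v in e
      ... | just _ = inj₁ (λ ())
      ... | nothing with step σ v i e
      ...   | inj₁ s = inj₁ (λ _ → s)
      ...   | inj₂ r = inj₂ (v , e , r)
    ... | inj₁ s = σ , i , s
    ... | inj₂ (v , e , x , i′) = go b (upd σ v x) (≤-trans (blank-upd σ v x e) lt) i′

-- Choosing pairs along even cycles

-- `full` is conditional because vertices off the cycles will have an empty list and need no pair.
record CyclePairs {n : ℕ} (nxt : Fin n → Fin n) (R : Fin n → List ℕ) : Set where
  field
    taken  : Fin n → List ℕ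
    unique : ∀ v → Unique (taken v)
    sound  : ∀ v {z} → z ∈ taken v → z ∈ R v
    apart  : ∀ v {z} → z ∈ taken v → z ∉ taken (nxt v)
    full   : ∀ v → Unique (R v) → 4 ≤ length (R v) → length (taken v) ≡ 2

module _ {n : ℕ} (nxt : Fin n → Fin n) (par : Fin n → Bool) where

  -- A kernel of the digraph with arcs from `v` to `nxt v`, induced on the active vertices: an
  -- independent set into which every other active vertex has its arc.
  IsKernel : (Fin n → Bool) → (Fin n → Bool) → Set
  IsKernel act S = (∀ v → S v ≡ true → act v ≡ true × S (nxt v) ≡ false) ×
                   (∀ v → act v ≡ true → S v ≡ false → S (nxt v) ≡ true)

  -- An inactive vertex is outside the kernel, and the status of `nxt v` forces that of an active
  -- `v`. Vertices never reached by this propagation are active and closed under `nxt`; there the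
  -- alternating `par` is itself a kernel.
  kernel : ∀ act → (∀ v → act v ≡ true → par (nxt v) ≡ not (par v)) → ∃[ S ] IsKernel act S
  kernel act flip with saturate {Inv = Inv} {Stuck} step (λ _ → nothing) ((λ _ ()) , (λ _ ()))
    where
    Inv : (Fin n → Maybe Bool) → Set
    Inv σ = (∀ v → σ v ≡ just true → act v ≡ true × σ (nxt v) ≡ just false) ×
            (∀ v → σ v ≡ just false → act v ≡ false ⊎ σ (nxt v) ≡ just true)
    Stuck : (Fin n → Maybe Bool) → Fin n → Set
    Stuck σ v = act v ≡ true × σ (nxt v) ≡ nothing
    step : ∀ σ v → Inv σ → σ v ≡ nothing → Stuck σ v ⊎ ∃[ x ] Inv (upd σ v x)
    step σ v (i₁ , i₂) e = decide (act v) refl (σ (nxt v)) refl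
      where
      put : ∀ b → (b ≡ true → act v ≡ true × σ (nxt v) ≡ just false) →
            (b ≡ false → act v ≡ false ⊎ σ (nxt v) ≡ just true) → Inv (upd σ v b)
      put b h₁ h₂ = j₁ , j₂
        where
        j₁ : ∀ u → upd σ v b u ≡ just true → act u ≡ true × upd σ v b (nxt u) ≡ just false
        j₁ u f with upd-inv σ v b f
        ... | inj₁ (refl , q) = proj₁ (h₁ q) , upd-ext σ v b e (proj₂ (h₁ q))
        ... | inj₂ g = proj₁ (i₁ u g) , upd-ext σ v b e (proj₂ (i₁ u g))
        j₂ : ∀ u → upd σ v b u ≡ just false → act u ≡ false ⊎ upd σ v b (nxt u) ≡ just true
        j₂ u f with upd-inv σ v b f
        ... | inj₁ (refl , q) with h₂ q
        ...   | inj₁ p = inj₁ p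
        ...   | inj₂ p = inj₂ (upd-ext σ v b e p)
        j₂ u f | inj₂ g with i₂ u g
        ...   | inj₁ p = inj₁ p
        ...   | inj₂ p = inj₂ (upd-ext σ v b e p)
      decide : ∀ a → act v ≡ a → ∀ m → σ (nxt v) ≡ m → Stuck σ v ⊎ ∃[ x ] Inv (upd σ v x)
      decide false p _ _ = inj₂ (false , put false (λ ()) (λ _ → inj₁ p))
      decide true p nothing q = inj₁ (p , q)
      decide true p (just false) q = inj₂ (true , put true (λ _ → p , q) (λ ()))
      decide true p (just true) q = inj₂ (false , put false (λ ()) (λ _ → inj₂ q))
  ... | σ , (i₁ , i₂) , stuck = S , k₁ , k₂
    where
    S : Fin n → Bool
    S v = fromMaybe (par v) (σ v)
    at : ∀ v {b} → σ v ≡ just b → S v ≡ b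
    at v e rewrite e = refl
    free : ∀ v → σ v ≡ nothing → S v ≡ par v
    free v e rewrite e = refl
    k₁ : ∀ v → S v ≡ true → act v ≡ true × S (nxt v) ≡ false
    k₁ v s with σ v in e
    ... | just true = proj₁ (i₁ v e) , at (nxt v) (proj₂ (i₁ v e))
    ... | nothing = let a , q = stuck v e in
          a , trans (free (nxt v) q) (trans (flip v a) (cong not s))
    k₂ : ∀ v → act v ≡ true → S v ≡ false → S (nxt v) ≡ true
    k₂ v a s with σ v in e
    ... | nothing = let _ , q = stuck v e in
          trans (free (nxt v) q) (trans (flip v a) (cong not s))
    ... | just false with i₂ v e
    ...   | inj₂ q = at (nxt v) q
    ...   | inj₁ b with trans (≡-sym a) b
    ...     | ()

  module _ (R : Fin n → List ℕ) (flip : ∀ v {x} → x ∈ R v → par (nxt v) ≡ not (par v)) where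

    -- The state after the colours of `cs` have been distributed. By `covered`, a vertex that still
    -- lacks a colour has lost each processed colour of its list only to its successor.
    record Choice (cs : List ℕ) : Set where
      field
        taken   : Fin n → List ℕ
        short   : ∀ v → length (taken v) ≤ 2
        unique  : ∀ v → Unique (taken v)
        sound   : ∀ v {z} → z ∈ taken v → z ∈ R v × z ∈ cs
        apart   : ∀ v {z} → z ∈ taken v → z ∉ taken (nxt v)
        covered : ∀ v {z} → z ∈ cs → z ∈ R v →
                  length (taken v) ≡ 2 ⊎ z ∈ taken v ⊎ z ∈ taken (nxt v)

    -- A new colour `c` is given to a kernel of the vertices that have `c` in their list and fewer
    -- than two colours so far. Independence of the kernel yields `apart`, absorption yields
    -- `covered`.
    choose : ∀ cs → Choice cs
    choose [] = record
      { taken = λ _ → [] ; short = λ _ → z≤n ; unique = λ _ → [] ; sound = λ _ () ; apart = λ _ () ; covered = λ _ () }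
    choose (c ∷ cs) with c ∈? cs | choose cs
    -- The colours are collected from all lists and recur; a repeated one has been distributed
    -- already.
    ... | yes c∈ | ch = record
      { Choice ch ; sound = λ v z∈ → let r , s = Choice.sound ch v z∈ in r , there s
      ; covered = λ { v (here refl) → Choice.covered ch v c∈ ; v (there z∈) → Choice.covered ch v z∈ } }
    ... | no c∉ | ch = record
      { taken = taken′ ; short = short′ ; unique = unique′ ; sound = sound′ ; apart = apart′ ; covered = covered′ }
      where
      open Choice ch
      Act : Fin n → Set
      Act v = c ∈ R v × length (taken v) < 2
      act? : ∀ v → Dec (Act v)
      act? v = (c ∈? R v) ×-dec (length (taken v) <? 2)
      isAct : ∀ v → does (act? v) ≡ true → Act v
      isAct v = does⇒ (act? v)
      ker = kernel (λ v → does (act? v)) (λ v e → flip v (proj₁ (isAct v e)))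
      S = proj₁ ker
      k₁ = proj₁ (proj₂ ker)
      k₂ = proj₂ (proj₂ ker)
      taken′ : Fin n → List ℕ
      taken′ v = if S v then c ∷ taken v else taken v
      short′ : ∀ v → length (taken′ v) ≤ 2
      short′ v with S v in e
      ... | false = short v
      ... | true = proj₂ (isAct v (proj₁ (k₁ v e)))
      unique′ : ∀ v → Unique (taken′ v)
      unique′ v with S v
      ... | false = unique v
      ... | true = All.tabulate (λ z∈ e → c∉ (subst (_∈ cs) (≡-sym e) (proj₂ (sound v z∈)))) ∷ unique v
      sound′ : ∀ v {z} → z ∈ taken′ v → z ∈ R v × z ∈ c ∷ cs
      sound′ v z∈ with S v in e
      ... | false = let r , s = sound v z∈ in r , there s
      sound′ v (here refl) | true = proj₁ (isAct v (proj₁ (k₁ v e))) , here refl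
      sound′ v (there z∈) | true = let r , s = sound v z∈ in r , there s
      apart′ : ∀ v {z} → z ∈ taken′ v → z ∉ taken′ (nxt v)
      apart′ v p q with S v in e | S (nxt v) in f
      ... | false | false = apart v p q
      apart′ v p (here refl) | false | true = c∉ (proj₂ (sound v p))
      apart′ v p (there q) | false | true = apart v p q
      apart′ v (here refl) q | true | false = c∉ (proj₂ (sound (nxt v) q))
      apart′ v (there p) q | true | false = apart v p q
      ... | true | true with trans (≡-sym f) (proj₂ (k₁ v e))
      ...   | ()
      grow : ∀ v {z} → z ∈ taken v → z ∈ taken′ v
      grow v z∈ with S v
      ... | true = there z∈
      ... | false = z∈
      has : ∀ v → S v ≡ true → c ∈ taken′ v
      has v e rewrite e = here refl
      full : ∀ v → length (taken v) ≡ 2 → length (taken′ v) ≡ 2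
      full v l with S v in e
      ... | false = l
      ... | true = ⊥-elim (ℕₚ.<-irrefl l (proj₂ (isAct v (proj₁ (k₁ v e)))))
      covered′ : ∀ v {z} → z ∈ c ∷ cs → z ∈ R v →
                 length (taken′ v) ≡ 2 ⊎ z ∈ taken′ v ⊎ z ∈ taken′ (nxt v)
      covered′ v (there z∈) r with covered v z∈ r
      ... | inj₁ l = inj₁ (full v l)
      ... | inj₂ (inj₁ t) = inj₂ (inj₁ (grow v t))
      ... | inj₂ (inj₂ t) = inj₂ (inj₂ (grow (nxt v) t))
      covered′ v (here refl) r with length (taken v) <? 2
      ... | no ≮2 = inj₁ (full v (ℕₚ.≤-antisym (short v) (ℕₚ.≮⇒≥ ≮2)))
      ... | yes <2 with S v in e
      ...   | true = inj₂ (inj₁ (here refl))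
      ...   | false = inj₂ (inj₂ (has (nxt v) (k₂ v (dec-true (act? v) (r , <2)) e)))

    -- Each colour of R v not taken at v is taken at nxt v, where at most two are.
    cycle-pairs : CyclePairs nxt R
    cycle-pairs = record
      { taken = taken ; unique = unique ; sound = λ v z∈ → proj₁ (sound v z∈) ; apart = apart ; full = two }
      where
      cs : List ℕ
      cs = concatMap R (allFin n)
      open Choice (choose cs)
      two : ∀ v → Unique (R v) → 4 ≤ length (R v) → length (taken v) ≡ 2
      two v u l with length (taken v) ℕₚ.≟ 2
      ... | yes e = e
      ... | no ¬e = ⊥-elim (ℕₚ.<-irrefl refl bound)
        where
        sub : R v ⊆ taken v ++ taken (nxt v)
        sub z∈ with covered v (∈-concatMap⁺ R (lose (∈-allFin v) z∈)) z∈
        ... | inj₁ e = ⊥-elim (¬e e)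
        ... | inj₂ (inj₁ t) = ∈-++⁺ˡ t
        ... | inj₂ (inj₂ t) = ∈-++⁺ʳ (taken v) t
        bound : 4 ≤ 3
        bound = ≤-trans l (≤-trans (pigeonhole u sub) (≤-trans (≤-reflexive (length-++ (taken v)))
                  (ℕₚ.+-mono-≤ (ℕₚ.≤-pred (ℕₚ.≤∧≢⇒< (short v) ¬e)) (short (nxt v)))))

-- Pairs on the edges outside the cycles

-- `mat p` marks a vertex whose edge outside the cycles is a matching edge to `p`, and `pend i k`
-- marks leaf `k` of star `i`.
data Kind (n s : ℕ) : Set where
  mat  : Fin n → Kind n s
  pend : Fin s → Fin 4 → Kind n s

pend-injective : ∀ {n s i j k l} → pend {n} {s} i k ≡ pend j l → i ≡ j × k ≡ l
pend-injective refl = refl , refl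

sib : Fin 4 → Fin 4
sib #0 = fs #0
sib (fs #0) = #0
sib (fs (fs #0)) = fs (fs (fs #0))
sib (fs (fs (fs #0))) = fs (fs #0)

sib-sib : ∀ k → sib (sib k) ≡ k
sib-sib = from-yes (Finₚ.all? λ k → sib (sib k) Finₚ.≟ k)

sib-≢ : ∀ k → k ≢ sib k
sib-≢ = from-yes (Finₚ.all? λ k → ¬? (k Finₚ.≟ sib k))

other-siblings : ∀ k l m → l ≢ k → l ≢ sib k → m ≢ k → m ≢ sib k → m ≡ l ⊎ m ≡ sib l
other-siblings = from-yes (Finₚ.all? λ k → Finₚ.all? λ l → Finₚ.all? λ m →
  ¬? (l Finₚ.≟ k) →-dec (¬? (l Finₚ.≟ sib k) →-dec (¬? (m Finₚ.≟ k) →-dec (¬? (m Finₚ.≟ sib k) →-dec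
  ((m Finₚ.≟ l) ⊎-dec (m Finₚ.≟ sib l))))))

-- For a vertex v on a cycle, Lv v is the list of its edge outside the cycles and Av v the list of the
-- cycle edge joining v to nxt v.  Vertices off the cycles are harmless fixed points of nxt.
record Instance (n s : ℕ) : Set₁ where
  field
    nxt     : Fin n → Fin n
    kind    : Fin n → Kind n s
    lf      : Fin s → Fin 4 → Fin n
    Lv Av   : Fin n → List ℕ
    Kc      : Fin s → List ℕ
    Lv-7    : ∀ v → Seven (Lv v)
    Av-7    : ∀ v → Seven (Av v)
    Kc-7    : ∀ i → Seven (Kc i)
    kind-lf : ∀ i k → kind (lf i k) ≡ pend i k
    lf-kind : ∀ {v i k} → kind v ≡ pend i k → v ≡ lf i k
    partner : ∀ {v p} → kind v ≡ mat p → kind p ≡ mat v × Lv p ≡ Lv v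
    indep   : ∀ {v i k} → kind v ≡ pend i k → ∃[ p ] kind (nxt v) ≡ mat p
    flat    : ∀ (Z : Fin n → Set) → (∀ v → Z v → Z (nxt v) × Lv v ⊆ Av v) →
              ∀ v → Z v → Av v ⊆ Lv (nxt v)

-- The budget of a central edge with list `K`: the first colours of its four leaves may use up three
-- of the seven. The second colours of the two cut leaves use up at most two more, and two remain.
AtMostThree : List ℕ → ℕ → ℕ → ℕ → ℕ → Set
AtMostThree K a b c d = ∃[ D ] (length D ≤ 3 × (∀ {z} → z ∈ a ∷ b ∷ c ∷ d ∷ [] → z ∈ K → z ∈ D))

AtMostThree-swap : ∀ {K a b c d} → AtMostThree K a b c d → AtMostThree K c d a b
AtMostThree-swap (D , l , cov) = D , l , λ
  { (here e) → cov (there (there (here e)))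
  ; (there (here e)) → cov (there (there (there (here e))))
  ; (there (there (here e))) → cov (here e)
  ; (there (there (there (here e)))) → cov (there (here e)) }

-- A 7-set minus one colour cannot avoid both c and d unless it reaches outside K.
pick-AtMostThree : ∀ {xs K} f c d → Seven xs → Seven K → c ≢ d →
                   ∃[ q ] (q ∈ xs × q ≢ f × AtMostThree K q f c d)
pick-AtMostThree {xs} {K} f c d sx sK c≢d with pick-near {xs} {K} f c d sx sK c≢d
... | q , q∈ , q≢f , inj₁ c∉ = q , q∈ , q≢f , (q ∷ f ∷ d ∷ []) , ≤-refl , λ
  { (here e) _ → here e ; (there (here e)) _ → there (here e)
  ; (there (there (here refl))) z∈ → ⊥-elim (c∉ z∈) ; (there (there (there (here e)))) _ → there (there (here e)) }
... | q , q∈ , q≢f , inj₂ (inj₁ d∉) = q , q∈ , q≢f , (q ∷ f ∷ c ∷ []) , ≤-refl , λ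
  { (here e) _ → here e ; (there (here e)) _ → there (here e)
  ; (there (there (here e))) _ → there (there (here e)) ; (there (there (there (here refl)))) z∈ → ⊥-elim (d∉ z∈) }
... | q , q∈ , q≢f , inj₂ (inj₂ near) = q , q∈ , q≢f , (f ∷ c ∷ d ∷ []) , ≤-refl , λ
  { (here refl) z∈ → cov near z∈ ; (there z∈) _ → z∈ }
  where
  cov : ∀ {q} → q ∉ K ⊎ q ≡ c ⊎ q ≡ d → q ∈ K → q ∈ f ∷ c ∷ d ∷ []
  cov (inj₁ q∉) q∈ = ⊥-elim (q∉ q∈)
  cov (inj₂ (inj₁ e)) _ = there (here e)
  cov (inj₂ (inj₂ e)) _ = there (there (here e))

_∈₂_ : ℕ → ℕ × ℕ → Set
z ∈₂ (a , b) = z ≡ a ⊎ z ≡ b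

Disjoint₂ : ℕ × ℕ → ℕ × ℕ → Set
Disjoint₂ p q = ∀ {z} → z ∈₂ p → z ∈₂ q → ⊥

PairFrom : List ℕ → ℕ × ℕ → Set
PairFrom L (a , b) = a ∈ L × b ∈ L × a ≢ b

-- `Q` stands for the pair of the central edge, `ma` and `mb` for the first colours of two sibling
-- leaves, `ta` and `tb` for their second colours. The last two matter only at a cut leaf; elsewhere
-- they repeat the first.
record SiblingPairs (Q : ℕ × ℕ) (La Lb : List ℕ) (ma mb ta tb : ℕ) : Set where
  field
    Pa Pb : ℕ × ℕ
    ma∈ : ma ∈₂ Pa
    ta∈ : ta ∈₂ Pa
    mb∈ : mb ∈₂ Pb
    tb∈ : tb ∈₂ Pb
    fromA : PairFrom La Pa
    fromB : PairFrom Lb Pb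
    a#b : Disjoint₂ Pa Pb
    q#a : Disjoint₂ Q Pa
    q#b : Disjoint₂ Q Pb

swap-siblings : ∀ {Q La Lb ma mb ta tb} → SiblingPairs Q La Lb ma mb ta tb → SiblingPairs Q Lb La mb ma tb ta
swap-siblings r = record
  { Pa = Pb ; Pb = Pa ; ma∈ = mb∈ ; ta∈ = tb∈ ; mb∈ = ma∈ ; tb∈ = ta∈ ; fromA = fromB ; fromB = fromA
  ; a#b = λ p q → a#b q p ; q#a = q#b ; q#b = q#a }
  where open SiblingPairs r

-- The leaf with list `La` has just one prescribed colour. The other leaf is completed first, with
-- `t` or, if `t` is `mb`, with a colour avoiding four others; the filler of the first leaf then has
-- to avoid only five colours.
sibling-pairs : ∀ {La Lb} Q {ma mb t} → Seven La → Seven Lb → ma ∈ La → mb ∈ Lb → t ∈ Lb →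
                ma ≢ mb → t ≢ ma → ¬ ma ∈₂ Q → ¬ mb ∈₂ Q → ¬ t ∈₂ Q → SiblingPairs Q La Lb ma mb ma t
sibling-pairs {La} {Lb} (q₁ , q₂) {ma} {mb} {t} sa sb ma∈ mb∈ t∈ ma≢mb t≢ma ma∉ mb∉ t∉ = record
  { Pa = ma , w ; Pb = mb , u
  ; ma∈ = inj₁ refl ; ta∈ = inj₁ refl ; mb∈ = inj₁ refl ; tb∈ = t-in
  ; fromA = ma∈ , w∈ , (λ e → w∉ (here (≡-sym e)))
  ; fromB = mb∈ , u∈ , (λ e → u≢mb (≡-sym e))
  ; a#b = λ { (inj₁ refl) (inj₁ e) → ma≢mb e ; (inj₁ refl) (inj₂ e) → u≢ma (≡-sym e)
            ; (inj₂ refl) (inj₁ e) → w∉ (there (here e)) ; (inj₂ refl) (inj₂ e) → w∉ (there (there (here e))) }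
  ; q#a = λ { z∈ (inj₁ refl) → ma∉ z∈ ; (inj₁ e) (inj₂ refl) → w∉ (there (there (there (here e))))
            ; (inj₂ e) (inj₂ refl) → w∉ (there (there (there (there (here e))))) }
  ; q#b = λ { z∈ (inj₁ refl) → mb∉ z∈ ; z∈ (inj₂ refl) → u∉Q z∈ } }
  where
  second : ∃[ x ] (x ∈ Lb × x ≢ mb × x ≢ ma × ¬ x ∈₂ (q₁ , q₂) × t ∈₂ (mb , x))
  second with t ℕₚ.≟ mb
  ... | no t≢mb = t , t∈ , t≢mb , t≢ma , t∉ , inj₂ refl
  ... | yes t≡mb with pick (mb ∷ ma ∷ q₁ ∷ q₂ ∷ []) sb (s≤s (s≤s (s≤s (s≤s (s≤s z≤n)))))
  ...   | x , x∈ , x∉ = x , x∈ , (λ e → x∉ (here e)) , (λ e → x∉ (there (here e))) ,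
          (λ { (inj₁ e) → x∉ (there (there (here e))) ; (inj₂ e) → x∉ (there (there (there (here e)))) }) ,
          inj₁ t≡mb
  u = proj₁ second
  u∈ = proj₁ (proj₂ second)
  u≢mb = proj₁ (proj₂ (proj₂ second))
  u≢ma = proj₁ (proj₂ (proj₂ (proj₂ second)))
  u∉Q = proj₁ (proj₂ (proj₂ (proj₂ (proj₂ second))))
  t-in = proj₂ (proj₂ (proj₂ (proj₂ (proj₂ second))))
  filler = pick (ma ∷ mb ∷ u ∷ q₁ ∷ q₂ ∷ []) sa (s≤s (s≤s (s≤s (s≤s (s≤s (s≤s z≤n))))))
  w = proj₁ filler
  w∈ = proj₁ (proj₂ filler)
  w∉ = proj₂ (proj₂ filler)

-- Greedy colouring of the vertices, backwards along the cycles

module Saturation {n s : ℕ} (I : Instance n s) where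
  open Instance I

  lf-injective : ∀ {i j k l} → lf i k ≡ lf j l → i ≡ j × k ≡ l
  lf-injective {i} {j} {k} {l} e =
    pend-injective (trans (≡-sym (kind-lf i k)) (trans (cong kind e) (kind-lf j l)))

  -- A coloured vertex carries its colour and whether it is cut: a cut leaf leaves its edge to nxt v
  -- to be served by its second colour, chosen once all matching edges have both colours.
  State : Set
  State = Fin n → Maybe (ℕ × Bool)

  -- The colour `y` at `u` saves one colour of `Av v`: it either lies outside that list or coincides
  -- with `x` and is counted once.
  Serves : State → Fin n → ℕ → Fin n → Set
  Serves σ v x u = ∃[ y ] ∃[ b ] (σ u ≡ just (y , b) × (y ∉ Av v ⊎ y ≡ x))

  Good : State → Fin n → ℕ → Set
  Good σ v x = x ∉ Av v ⊎ Serves σ v x (nxt v) ⊎ ∃[ p ] (kind (nxt v) ≡ mat p × Serves σ v x p)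

  -- Cut leaves are exempt from `good`. Together, `cut` and `oneCut` say that of two coloured
  -- siblings exactly one is cut. In `budget`, `k` and `l` are therefore cut leaves at different
  -- centres of the star.
  record Inv (σ : State) : Set where
    field
      inL    : ∀ v {x b} → σ v ≡ just (x , b) → x ∈ Lv v
      good   : ∀ v {x} → σ v ≡ just (x , false) → Good σ v x
      cut    : ∀ v {x} → σ v ≡ just (x , true) →
               ∃[ i ] ∃[ k ] ∃[ y ] (kind v ≡ pend i k × σ (lf i (sib k)) ≡ just (y , false) × x ≢ y)
      oneCut : ∀ i k {x y} → σ (lf i k) ≡ just (x , false) → σ (lf i (sib k)) ≡ just (y , false) → ⊥
      budget : ∀ i k l {x y x′ y′} → k ≢ l →
               σ (lf i k) ≡ just (x , true) → σ (lf i (sib k)) ≡ just (y , false) →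
               σ (lf i l) ≡ just (x′ , true) → σ (lf i (sib l)) ≡ just (y′ , false) →
               AtMostThree (Kc i) x y x′ y′

  cut-lf : ∀ {σ} → Inv σ → ∀ i k {x} → σ (lf i k) ≡ just (x , true) →
           ∃[ y ] (σ (lf i (sib k)) ≡ just (y , false) × x ≢ y)
  cut-lf inv i k e with Inv.cut inv _ e
  ... | j , l , y , kd , f , x≢y with pend-injective (trans (≡-sym (kind-lf i k)) kd)
  ...   | refl , refl = y , f , x≢y

  -- Besides `Lv v ⊆ Av v`, these conditions close the set of blank vertices under siblings,
  -- successors and partners of successors, so that it can later be coloured uniformly.
  Stuck : State → Fin n → Set
  Stuck σ v = (∀ i k → kind v ≡ pend i k → σ (lf i (sib k)) ≡ nothing) × Lv v ⊆ Av v ×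
              σ (nxt v) ≡ nothing × (∀ p → kind (nxt v) ≡ mat p → σ p ≡ nothing)

  clash : ∀ {A B : Set} {m : Maybe A} {x : A} → m ≡ nothing → m ≡ just x → B
  clash refl ()

  module Extend (σ : State) (v : Fin n) (inv : Inv σ) (σv : σ v ≡ nothing) where
    open Inv inv

    module _ (x : ℕ) (c : Bool) where
      private
        τ : State
        τ = upd σ v (x , c)

      ext : ∀ {u z} → σ u ≡ just z → τ u ≡ just z
      ext = upd-ext σ v (x , c) σv

      serves-ext : ∀ {w y u} → Serves σ w y u → Serves τ w y u
      serves-ext (y , b , e , r) = y , b , ext e , r

      good-ext : ∀ {w y} → Good σ w y → Good τ w y
      good-ext (inj₁ p) = inj₁ p
      good-ext (inj₂ (inj₁ p)) = inj₂ (inj₁ (serves-ext p))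
      good-ext (inj₂ (inj₂ (p , kd , r))) = inj₂ (inj₂ (p , kd , serves-ext r))

      inL-ext : x ∈ Lv v → ∀ u {y b} → τ u ≡ just (y , b) → y ∈ Lv u
      inL-ext x∈ u e with upd-inv σ v (x , c) e
      ... | inj₁ (refl , refl) = x∈
      ... | inj₂ f = inL u f

    -- As the sibling of `v`, if any, is blank, no pair of coloured siblings arises, and `oneCut`
    -- and `budget` concern old vertices only.
    plain : ∀ x → x ∈ Lv v → Good σ v x →
            (∀ i k → kind v ≡ pend i k → σ (lf i (sib k)) ≡ nothing) → Inv (upd σ v (x , false))
    plain x x∈ g lone = record
      { inL = inL-ext x false x∈ ; good = good′ ; cut = cut′ ; oneCut = oneCut′ ; budget = budget′ }
      where
      τ : State
      τ = upd σ v (x , false)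
      good′ : ∀ u {y} → τ u ≡ just (y , false) → Good τ u y
      good′ u e with upd-inv σ v (x , false) e
      ... | inj₁ (refl , refl) = good-ext x false g
      ... | inj₂ f = good-ext x false (good u f)
      old : ∀ {u y} → τ u ≡ just (y , true) → σ u ≡ just (y , true)
      old e with upd-inv σ v (x , false) e
      ... | inj₁ (_ , ())
      ... | inj₂ f = f
      cut′ : ∀ u {y} → τ u ≡ just (y , true) →
             ∃[ i ] ∃[ k ] ∃[ z ] (kind u ≡ pend i k × τ (lf i (sib k)) ≡ just (z , false) × y ≢ z)
      cut′ u e = let i , k , z , kd , f , y≢z = cut u (old e) in i , k , z , kd , ext x false f , y≢z
      new : ∀ {i k y b} → lf i k ≡ v → σ (lf i (sib k)) ≡ just (y , b) → ⊥
      new {i} {k} refl f = clash (lone i k (kind-lf i k)) f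
      oneCut′ : ∀ i k {y z} → τ (lf i k) ≡ just (y , false) → τ (lf i (sib k)) ≡ just (z , false) → ⊥
      oneCut′ i k e f with upd-inv σ v (x , false) e | upd-inv σ v (x , false) f
      ... | inj₂ e′ | inj₂ f′ = oneCut i k e′ f′
      ... | inj₁ (p , _) | inj₂ f′ = new p f′
      ... | inj₂ e′ | inj₁ (q , _) = new q (subst (λ m → σ (lf i m) ≡ _) (≡-sym (sib-sib k)) e′)
      ... | inj₁ (p , _) | inj₁ (q , _) = sib-≢ k (proj₂ (lf-injective (trans p (≡-sym q))))
      oldSib : ∀ i k {y z} → τ (lf i k) ≡ just (y , true) → τ (lf i (sib k)) ≡ just (z , false) →
               σ (lf i (sib k)) ≡ just (z , false)
      oldSib i k e f with cut-lf inv i k (old e)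
      ... | z₀ , f₀ , _ = trans f₀ (trans (≡-sym (ext x false f₀)) f)
      budget′ : ∀ i k l {x y x′ y′} → k ≢ l →
                τ (lf i k) ≡ just (x , true) → τ (lf i (sib k)) ≡ just (y , false) →
                τ (lf i l) ≡ just (x′ , true) → τ (lf i (sib l)) ≡ just (y′ , false) →
                AtMostThree (Kc i) x y x′ y′
      budget′ i k l k≢l e f e′ f′ = budget i k l k≢l (old e) (oldSib i k e f) (old e′) (oldSib i l e′ f′)

    cutting : ∀ q i k y → v ≡ lf i k → σ (lf i (sib k)) ≡ just (y , false) → q ∈ Lv v → q ≢ y →
              (∀ l {x′ y′} → σ (lf i l) ≡ just (x′ , true) → σ (lf i (sib l)) ≡ just (y′ , false) →
               AtMostThree (Kc i) q y x′ y′) → Inv (upd σ v (q , true))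
    cutting q i k y v≡ σsib q∈ q≢y bud = record
      { inL = inL-ext q true q∈ ; good = good′ ; cut = cut′ ; oneCut = oneCut′ ; budget = budget′ }
      where
      τ : State
      τ = upd σ v (q , true)
      old : ∀ {u y} → τ u ≡ just (y , false) → σ u ≡ just (y , false)
      old e with upd-inv σ v (q , true) e
      ... | inj₁ (_ , ())
      ... | inj₂ f = f
      good′ : ∀ u {y} → τ u ≡ just (y , false) → Good τ u y
      good′ u e = good-ext q true (good u (old e))
      cut′ : ∀ u {y} → τ u ≡ just (y , true) →
             ∃[ i ] ∃[ k ] ∃[ z ] (kind u ≡ pend i k × τ (lf i (sib k)) ≡ just (z , false) × y ≢ z)
      cut′ u e with upd-inv σ v (q , true) e
      ... | inj₁ (refl , refl) = i , k , y , trans (cong kind v≡) (kind-lf i k) , ext q true σsib , q≢y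
      ... | inj₂ e′ = let i , k , z , kd , f , y≢z = cut u e′ in i , k , z , kd , ext q true f , y≢z
      oneCut′ : ∀ i k {y z} → τ (lf i k) ≡ just (y , false) → τ (lf i (sib k)) ≡ just (z , false) → ⊥
      oneCut′ i k e f = oneCut i k (old e) (old f)
      fresh : ∀ {j l m x₁ x₂ y₁ y₂} → lf j l ≡ v → q ≡ x₁ → σ (lf j (sib l)) ≡ just (y₁ , false) →
              σ (lf j m) ≡ just (x₂ , true) → σ (lf j (sib m)) ≡ just (y₂ , false) →
              AtMostThree (Kc j) x₁ y₁ x₂ y₂
      fresh p refl f e′ f′ with lf-injective (trans p v≡)
      ... | refl , refl with just-injective (trans (≡-sym σsib) f)
      ...   | refl = bud _ e′ f′
      budget′ : ∀ i k l {x y x′ y′} → k ≢ l →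
                τ (lf i k) ≡ just (x , true) → τ (lf i (sib k)) ≡ just (y , false) →
                τ (lf i l) ≡ just (x′ , true) → τ (lf i (sib l)) ≡ just (y′ , false) →
                AtMostThree (Kc i) x y x′ y′
      budget′ i k l k≢l e f e′ f′ with upd-inv σ v (q , true) e | upd-inv σ v (q , true) e′
      ... | inj₂ g | inj₂ g′ = budget i k l k≢l g (old f) g′ (old f′)
      ... | inj₁ (p , r) | inj₂ g′ = fresh p (cong proj₁ r) (old f) g′ (old f′)
      ... | inj₂ g | inj₁ (p , r) = AtMostThree-swap (fresh p (cong proj₁ r) (old f′) g (old f))
      ... | inj₁ (p , _) | inj₁ (p′ , _) = ⊥-elim (k≢l (proj₂ (lf-injective (trans p (≡-sym p′)))))

    -- The first cut leaf of a star only has to differ from its sibling. When the other centre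
    -- already has a cut leaf, `pick-AtMostThree` chooses the colour so that the budget of the
    -- central edge is kept.
    cut-step : ∀ i k y → kind v ≡ pend i k → σ (lf i (sib k)) ≡ just (y , false) → ∃[ c ] Inv (upd σ v c)
    cut-step i k y kd σsib with Finₚ.any? isCut?
      where
      isCut? : ∀ l → Dec (∃[ x ] σ (lf i l) ≡ just (x , true))
      isCut? l with σ (lf i l)
      ... | nothing = no (λ ())
      ... | just (x , false) = no (λ ())
      ... | just (x , true) = yes (x , refl)
    ... | no none = let q , q∈ , q∉ = pick (y ∷ []) (Lv-7 v) (s≤s (s≤s z≤n)) in
      (q , true) , cutting q i k y (lf-kind kd) σsib q∈ (λ e → q∉ (here e)) (λ l e _ → ⊥-elim (none (l , _ , e)))
    ... | yes (l , x′ , e) with cut-lf inv i l e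
    ...   | y′ , f , x′≢y′ with pick-AtMostThree y x′ y′ (Lv-7 v) (Kc-7 i) x′≢y′
    ...     | q , q∈ , q≢y , b = (q , true) , cutting q i k y (lf-kind kd) σsib q∈ q≢y bud
      where
      σlf : σ (lf i k) ≡ nothing
      σlf = subst (λ u → σ u ≡ nothing) (lf-kind kd) σv
      notSelf : ∀ {m x} → σ (lf i m) ≡ just (x , true) → m ≢ k
      notSelf g refl = clash σlf g
      notSib : ∀ {m x} → σ (lf i m) ≡ just (x , true) → m ≢ sib k
      notSib g refl with trans (≡-sym g) σsib
      ... | ()
      bud : ∀ m {x″ y″} → σ (lf i m) ≡ just (x″ , true) → σ (lf i (sib m)) ≡ just (y″ , false) →
            AtMostThree (Kc i) q y x″ y″
      bud m g h with other-siblings k l m (notSelf e) (notSib e) (notSelf g) (notSib g)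
      ... | inj₁ refl with trans (≡-sym e) g | trans (≡-sym f) h
      ...   | refl | refl = b
      bud m g h | inj₂ refl with trans (≡-sym f) g
      ...   | ()

    plain-step : (∀ i k → kind v ≡ pend i k → σ (lf i (sib k)) ≡ nothing) →
                 Stuck σ v ⊎ ∃[ c ] Inv (upd σ v c)
    plain-step lone with Any.any? (λ x → ¬? (x ∈? Av v)) (Lv v)
    ... | yes a = let x , x∈ , x∉ = find a in inj₂ ((x , false) , plain x x∈ (inj₁ x∉) lone)
    ... | no ¬a = decide (σ (nxt v)) refl (kind (nxt v)) refl
      where
      sub : Lv v ⊆ Av v
      sub {z} z∈ with z ∈? Av v
      ... | yes z∈A = z∈A
      ... | no z∉A = ⊥-elim (¬a (lose z∈ z∉A))
      -- Here `Lv v` and `Av v` agree as sets, so a colour of `Av v` can be copied to `v`; a colour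
      -- outside `Av v` is a saving already, and then any colour of `Lv v` will do.
      copy : ∀ y → ∃[ x ] (x ∈ Lv v × (y ∉ Av v ⊎ y ≡ x))
      copy y with y ∈? Av v
      ... | yes y∈ = y , ⊆-reverse (Lv-7 v) (Av-7 v) sub y∈ , inj₂ refl
      ... | no y∉ = let x , x∈ , _ = pick [] (Lv-7 v) (s≤s z≤n) in x , x∈ , inj₁ y∉
      decide : ∀ m → σ (nxt v) ≡ m → ∀ κ → kind (nxt v) ≡ κ → Stuck σ v ⊎ ∃[ c ] Inv (upd σ v c)
      decide (just (y , b)) e _ _ = let x , x∈ , r = copy y in
        inj₂ ((x , false) , plain x x∈ (inj₂ (inj₁ (y , b , e , r))) lone)
      decide nothing e (pend i k) kd = inj₁ (lone , sub , e , λ p kp → absurd p (trans (≡-sym kd) kp))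
        where
        absurd : ∀ {B : Set} p → pend i k ≡ mat p → B
        absurd p ()
      decide nothing e (mat p) kd with σ p in f
      ... | just (y , b) = let x , x∈ , r = copy y in
        inj₂ ((x , false) , plain x x∈ (inj₂ (inj₂ (p , kd , y , b , f , r))) lone)
      ... | nothing = inj₁ (lone , sub , e , λ p′ kp → same p′ (trans (≡-sym kd) kp))
        where
        same : ∀ p′ → mat p ≡ mat p′ → σ p′ ≡ nothing
        same p′ refl = f

    step : Stuck σ v ⊎ ∃[ c ] Inv (upd σ v c)
    step = decide (kind v) refl
      where
      leaf-step : ∀ i k → kind v ≡ pend i k → ∀ m → σ (lf i (sib k)) ≡ m → Stuck σ v ⊎ ∃[ c ] Inv (upd σ v c)
      leaf-step i k kd (just (y , false)) e = inj₂ (cut-step i k y kd e)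
      -- A cut sibling would have been cut because of `v`, which is still blank.
      leaf-step i k kd (just (y , true)) e =
        let y′ , f , _ = cut-lf inv i (sib k) e
        in clash σv (subst (λ u → σ u ≡ just (y′ , false)) (≡-sym (trans (lf-kind kd) (cong (lf i) (≡-sym (sib-sib k))))) f)
      leaf-step i k kd nothing e = plain-step lone
        where
        lone : ∀ i′ k′ → kind v ≡ pend i′ k′ → σ (lf i′ (sib k′)) ≡ nothing
        lone i′ k′ kd′ with trans (≡-sym kd) kd′
        ... | refl = e
      decide : ∀ κ → kind v ≡ κ → Stuck σ v ⊎ ∃[ c ] Inv (upd σ v c)
      decide (pend i k) kd = leaf-step i k kd (σ (lf i (sib k))) refl
      decide (mat p) kd = plain-step lone
        where
        lone : ∀ i k → kind v ≡ pend i k → σ (lf i (sib k)) ≡ nothing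
        lone i k kd′ with trans (≡-sym kd) kd′
        ... | ()

  saturated : ∃[ σ ] (Inv σ × (∀ v → σ v ≡ nothing → Stuck σ v))
  saturated = saturate (λ σ v inv e → Extend.step σ v inv e) (λ _ → nothing) (record
    { inL = λ _ () ; good = λ _ () ; cut = λ _ () ; oneCut = λ _ _ () ; budget = λ _ _ _ _ () })

-- By `keeps`, one of the four entries of `P v` and `P (nxt v)` costs `Av v` nothing: it is outside
-- `Av v` or occurs in both pairs.
record Solution {n s : ℕ} (I : Instance n s) : Set where
  open Instance I
  field
    P       : Fin n → ℕ × ℕ
    Q       : Fin s → ℕ × ℕ
    P-from  : ∀ v → PairFrom (Lv v) (P v)
    Q-from  : ∀ i → PairFrom (Kc i) (Q i)
    P-mat   : ∀ {v p z} → kind v ≡ mat p → z ∈₂ P v → z ∈₂ P p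
    P-sib   : ∀ i k → Disjoint₂ (P (lf i k)) (P (lf i (sib k)))
    P-Q     : ∀ i k → Disjoint₂ (Q i) (P (lf i k))
    keeps   : ∀ v → ∃[ p ] (p ∈₂ P v × (p ∉ Av v ⊎ p ∈₂ P (nxt v))) ⊎ ∃[ p ] (p ∈₂ P (nxt v) × p ∉ Av v)

-- Completing the saturated colouring to pairs

module Pairs {n s : ℕ} (I : Instance n s) (σ : Fin n → Maybe (ℕ × Bool)) (inv : Saturation.Inv I σ)
             (stuck : ∀ v → σ v ≡ nothing → Saturation.Stuck I σ v) where
  open Instance I
  open Saturation I
  open Inv inv

  α β : Fin n → ℕ
  α v = proj₁ (two-least (Lv-7 v))
  β v = proj₁ (proj₂ (two-least (Lv-7 v)))

  two : ∀ v → TwoLeast (Lv v) (α v) (β v)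
  two v = proj₂ (proj₂ (two-least (Lv-7 v)))

  αβ-cong : ∀ {u v} → Lv u ⊆ Lv v → Lv v ⊆ Lv u → (α u , β u) ≡ (α v , β v)
  αβ-cong {u} {v} p q with two-least-unique p q (two u) (two v)
  ... | e , f rewrite e | f = refl

  αβ-mat : ∀ {v p} → kind v ≡ mat p → (α p , β p) ≡ (α v , β v)
  αβ-mat {v} {p} kd = αβ-cong (subst (Lv p ⊆_) e (λ z → z)) (subst (_⊆ Lv p) e (λ z → z))
    where
    e : Lv p ≡ Lv v
    e = proj₂ (partner kd)

  -- The blank vertices satisfy the hypotheses of `flat`, which gives `Lv v ⊆ Av v ⊆ Lv (nxt v)`.
  -- Lists of equal size are then equal as sets, and so are their two least colours.
  αβ-nxt : ∀ {v} → σ v ≡ nothing → (α v , β v) ≡ (α (nxt v) , β (nxt v))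
  αβ-nxt {v} e = αβ-cong (λ z∈ → A⊆ (sub z∈)) (⊆-reverse (Lv-7 v) (Lv-7 (nxt v)) (λ z∈ → A⊆ (sub z∈)))
    where
    sub : Lv v ⊆ Av v
    sub = proj₁ (proj₂ (stuck v e))
    A⊆ : Av v ⊆ Lv (nxt v)
    A⊆ = flat (λ u → σ u ≡ nothing)
           (λ u e → let _ , s , f , _ = stuck u e in f , s) v e

  αβ-in : ∀ {v z} → z ∈₂ (α v , β v) → z ∈ Lv v
  αβ-in {v} (inj₁ refl) = TwoLeast.a∈ (two v)
  αβ-in {v} (inj₂ refl) = TwoLeast.b∈ (two v)

  tie : ℕ → ℕ → ℕ → ℕ
  tie a b c with a ℕₚ.≟ c
  ... | yes _ = b
  ... | no _ = a

  tie-in : ∀ a b c → tie a b c ∈₂ (a , b)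
  tie-in a b c with a ℕₚ.≟ c
  ... | yes _ = inj₂ refl
  ... | no _ = inj₁ refl

  tie-≢ : ∀ a b c → a ≢ b → tie a b c ≢ c
  tie-≢ a b c a≢b with a ℕₚ.≟ c
  ... | yes refl = λ e → a≢b (≡-sym e)
  ... | no a≢c = a≢c

  -- Colours for blank leaves: each comes from the two least colours of its own list, and siblings
  -- differ although their lists may be unrelated.
  preset : Fin s → Fin 4 → ℕ
  preset i #0 = α (lf i #0)
  preset i (fs #0) = tie (α (lf i (fs #0))) (β (lf i (fs #0))) (α (lf i #0))
  preset i (fs (fs #0)) = α (lf i (fs (fs #0)))
  preset i (fs (fs (fs #0))) = tie (α (lf i (fs (fs (fs #0))))) (β (lf i (fs (fs (fs #0))))) (α (lf i (fs (fs #0))))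

  preset-in : ∀ i k → preset i k ∈₂ (α (lf i k) , β (lf i k))
  preset-in i #0 = inj₁ refl
  preset-in i (fs #0) = tie-in _ _ _
  preset-in i (fs (fs #0)) = inj₁ refl
  preset-in i (fs (fs (fs #0))) = tie-in _ _ _

  preset-≢ : ∀ i k → preset i k ≢ preset i (sib k)
  preset-≢ i #0 e = tie-≢ _ _ _ (TwoLeast.a≢b (two (lf i (fs #0)))) (≡-sym e)
  preset-≢ i (fs #0) e = tie-≢ _ _ _ (TwoLeast.a≢b (two (lf i (fs #0)))) e
  preset-≢ i (fs (fs #0)) e = tie-≢ _ _ _ (TwoLeast.a≢b (two (lf i (fs (fs (fs #0)))))) (≡-sym e)
  preset-≢ i (fs (fs (fs #0))) e = tie-≢ _ _ _ (TwoLeast.a≢b (two (lf i (fs (fs (fs #0)))))) e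

  colour : Maybe (ℕ × Bool) → ℕ → ℕ
  colour (just (x , _)) _ = x
  colour nothing d = d

  main : Fin s → Fin 4 → ℕ
  main i k = colour (σ (lf i k)) (preset i k)

  main-just : ∀ {i k x b} → σ (lf i k) ≡ just (x , b) → main i k ≡ x
  main-just {i} {k} e = cong (λ m → colour m (preset i k)) e

  main-nothing : ∀ {i k} → σ (lf i k) ≡ nothing → main i k ≡ preset i k
  main-nothing {i} {k} e = cong (λ m → colour m (preset i k)) e

  main-Z : ∀ {i k} → σ (lf i k) ≡ nothing → main i k ∈₂ (α (lf i k) , β (lf i k))
  main-Z {i} {k} e = subst (_∈₂ (α (lf i k) , β (lf i k))) (≡-sym (main-nothing e)) (preset-in i k)

  main-in : ∀ i k → main i k ∈ Lv (lf i k)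
  main-in i k with σ (lf i k) in e
  ... | just (x , b) = inL _ e
  ... | nothing = αβ-in (preset-in i k)

  sib-nothing : ∀ {i k} → σ (lf i k) ≡ nothing → σ (lf i (sib k)) ≡ nothing
  sib-nothing {i} {k} e = proj₁ (stuck _ e) i k (kind-lf i k)

  -- Siblings are both blank or both coloured, by `Stuck`. Blank ones differ by `preset-≢`; of
  -- coloured ones exactly one is cut, and its colour was chosen different from the other.
  main-≢ : ∀ i k → main i k ≢ main i (sib k)
  main-≢ i k = go (σ (lf i k)) refl (σ (lf i (sib k))) refl
    where
    back : ∀ {x b} → σ (lf i k) ≡ just (x , b) → σ (lf i (sib (sib k))) ≡ just (x , b)
    back = subst (λ m → σ (lf i m) ≡ _) (≡-sym (sib-sib k))
    go : ∀ m → σ (lf i k) ≡ m → ∀ m′ → σ (lf i (sib k)) ≡ m′ → main i k ≢ main i (sib k)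
    go nothing e (just _) f _ = clash (sib-nothing e) f
    go (just _) e nothing f _ = clash (sib-nothing f) (back e)
    go nothing e nothing f q = preset-≢ i k (trans (≡-sym (main-nothing e)) (trans q (main-nothing f)))
    go (just (x , false)) e (just (y , false)) f _ = oneCut i k e f
    go (just (x , true)) e (just (y , b)) f q with cut-lf inv i k e
    ... | y′ , f′ , x≢y′ = x≢y′ (trans (≡-sym (main-just e)) (trans q (main-just f′)))
    go (just (x , false)) e (just (y , true)) f q with cut-lf inv i (sib k) f
    ... | x′ , e′ , y≢x′ = y≢x′ (trans (≡-sym (main-just f)) (trans (≡-sym q)
          (main-just (subst (λ m → σ (lf i m) ≡ _) (sib-sib k) e′))))

  -- Pairs on the matching edges

  fallback : Fin n → Kind n s → ℕ
  fallback v (pend i k) = main i k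
  fallback v (mat _) = α v

  -- A blank end of a matching edge that precedes a leaf copies the first colour of that leaf, so
  -- the two pairs share a colour; before a matched vertex it takes `α`.
  mcol : Fin n → ℕ
  mcol v = colour (σ v) (fallback v (kind (nxt v)))

  mcol-just : ∀ {v x b} → σ v ≡ just (x , b) → mcol v ≡ x
  mcol-just {v} e = cong (λ m → colour m (fallback v (kind (nxt v)))) e

  mcol-nothing : ∀ {v} → σ v ≡ nothing → mcol v ≡ fallback v (kind (nxt v))
  mcol-nothing {v} e = cong (λ m → colour m (fallback v (kind (nxt v)))) e

  nxt-leaf-in : ∀ {v i k} → σ v ≡ nothing → kind (nxt v) ≡ pend i k → main i k ∈₂ (α v , β v)
  nxt-leaf-in {v} {i} {k} e kd = subst (main i k ∈₂_) (≡-sym (αβ-nxt e))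
    (subst (λ u → main i k ∈₂ (α u , β u)) (≡-sym (lf-kind kd))
      (main-Z (subst (λ u → σ u ≡ nothing) (lf-kind kd) (proj₁ (proj₂ (proj₂ (stuck v e)))))))

  mcol-in : ∀ v → mcol v ∈ Lv v
  mcol-in v = go (σ v) refl (kind (nxt v)) refl
    where
    go : ∀ m → σ v ≡ m → ∀ κ → kind (nxt v) ≡ κ → mcol v ∈ Lv v
    go (just (x , b)) e _ _ = subst (_∈ Lv v) (≡-sym (mcol-just e)) (inL v e)
    go nothing e (mat p) kd = subst (_∈ Lv v) (≡-sym (trans (mcol-nothing e) (cong (fallback v) kd))) (αβ-in (inj₁ refl))
    go nothing e (pend i k) kd =
      subst (_∈ Lv v) (≡-sym (trans (mcol-nothing e) (cong (fallback v) kd))) (αβ-in (nxt-leaf-in e kd))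

  -- Equal colours leave the second one free; it is taken from (α , β) so that it depends on the edge only.
  join : ℕ × ℕ → ℕ → ℕ → ℕ × ℕ
  join (a , b) c d with c ℕₚ.≟ d
  ... | yes _ = c , tie a b c
  ... | no _ = c , d

  join-left : ∀ ab c d → c ∈₂ join ab c d
  join-left _ c d with c ℕₚ.≟ d
  ... | yes _ = inj₁ refl
  ... | no _ = inj₁ refl

  join-right : ∀ ab c d → d ∈₂ join ab c d
  join-right _ c d with c ℕₚ.≟ d
  ... | yes e = inj₁ (≡-sym e)
  ... | no _ = inj₂ refl

  join-comm : ∀ ab c d {z} → z ∈₂ join ab c d → z ∈₂ join ab d c
  join-comm ab c d z∈ with c ℕₚ.≟ d | d ℕₚ.≟ c
  ... | yes refl | yes _ = z∈
  ... | yes e | no ¬e = ⊥-elim (¬e (≡-sym e))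
  ... | no ¬e | yes e = ⊥-elim (¬e (≡-sym e))
  join-comm ab c d (inj₁ e) | no _ | no _ = inj₂ e
  join-comm ab c d (inj₂ e) | no _ | no _ = inj₁ e

  join-from : ∀ v c d → c ∈ Lv v → d ∈ Lv v → PairFrom (Lv v) (join (α v , β v) c d)
  join-from v c d c∈ d∈ with c ℕₚ.≟ d
  ... | yes _ = c∈ , αβ-in (tie-in _ _ _) , (λ e → tie-≢ (α v) (β v) c (TwoLeast.a≢b (two v)) (≡-sym e))
  ... | no c≢d = c∈ , d∈ , c≢d

  matPair : Maybe (ℕ × Bool) → Maybe (ℕ × Bool) → ℕ × ℕ → ℕ → ℕ → ℕ × ℕ
  matPair nothing nothing ab _ _ = ab
  matPair (just _) _ ab c d = join ab c d
  matPair nothing (just _) ab c d = join ab c d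

  matPair-comm : ∀ m m′ ab c d {z} → z ∈₂ matPair m m′ ab c d → z ∈₂ matPair m′ m ab d c
  matPair-comm nothing nothing ab c d z∈ = z∈
  matPair-comm nothing (just _) ab c d z∈ = join-comm ab c d z∈
  matPair-comm (just _) nothing ab c d z∈ = join-comm ab c d z∈
  matPair-comm (just _) (just _) ab c d z∈ = join-comm ab c d z∈

  PM : Fin n → Fin n → ℕ × ℕ
  PM v p = matPair (σ v) (σ p) (α v , β v) (mcol v) (mcol p)

  PM-from : ∀ {v p} → kind v ≡ mat p → PairFrom (Lv v) (PM v p)
  PM-from {v} {p} kd = go (σ v) (σ p)
    where
    j : PairFrom (Lv v) (join (α v , β v) (mcol v) (mcol p))
    j = join-from v _ _ (mcol-in v) (subst (mcol p ∈_) (proj₂ (partner kd)) (mcol-in p))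
    go : ∀ m m′ → PairFrom (Lv v) (matPair m m′ (α v , β v) (mcol v) (mcol p))
    go nothing nothing = αβ-in (inj₁ refl) , αβ-in (inj₂ refl) , TwoLeast.a≢b (two v)
    go nothing (just _) = j
    go (just _) _ = j

  PM-comm : ∀ {v p z} → kind v ≡ mat p → z ∈₂ PM v p → z ∈₂ PM p v
  PM-comm {v} {p} {z} kd z∈ = subst (λ ab → z ∈₂ matPair (σ p) (σ v) ab (mcol p) (mcol v)) (≡-sym (αβ-mat kd))
    (matPair-comm (σ v) (σ p) (α v , β v) (mcol v) (mcol p) z∈)

  PM-left : ∀ {v p x b} → σ v ≡ just (x , b) → x ∈₂ PM v p
  PM-left {v} {p} {x} e = subst (_∈₂ PM v p) (mcol-just e) (go (σ v) e)
    where
    go : ∀ m {y} → m ≡ just y → mcol v ∈₂ matPair m (σ p) (α v , β v) (mcol v) (mcol p)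
    go (just _) _ = join-left _ (mcol v) (mcol p)

  PM-right : ∀ {v p y b} → σ p ≡ just (y , b) → y ∈₂ PM v p
  PM-right {v} {p} e = subst (_∈₂ PM v p) (mcol-just e) (go (σ v) (σ p) e)
    where
    go : ∀ m m′ {y} → m′ ≡ just y → mcol p ∈₂ matPair m m′ (α v , β v) (mcol v) (mcol p)
    go (just _) (just _) _ = join-right _ (mcol v) (mcol p)
    go nothing (just _) _ = join-right _ (mcol v) (mcol p)

  PM-Z : ∀ {v p} → σ v ≡ nothing → σ p ≡ nothing → PM v p ≡ (α v , β v)
  PM-Z {v} {p} e f = go (σ v) (σ p) e f
    where
    go : ∀ m m′ → m ≡ nothing → m′ ≡ nothing → matPair m m′ (α v , β v) (mcol v) (mcol p) ≡ (α v , β v)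
    go nothing nothing _ _ = refl

  -- If both ends are blank, the pair is all of `(α v , β v)`; if either end is coloured, `join`
  -- contains the colour `mcol v`.
  PM-half : ∀ {v p z} → z ∈₂ (α v , β v) → z ≡ mcol v → z ∈₂ PM v p
  PM-half {v} {p} {z} z∈ refl = go (σ v) (σ p)
    where
    go : ∀ m m′ → z ∈₂ matPair m m′ (α v , β v) (mcol v) (mcol p)
    go nothing nothing = z∈
    go nothing (just _) = join-left _ (mcol v) (mcol p)
    go (just _) _ = join-left _ (mcol v) (mcol p)

  -- Second colours of cut leaves

  IsCut : Fin s → Fin 4 → Set
  IsCut i k = ∃[ x ] σ (lf i k) ≡ just (x , true)

  isCut? : ∀ i k → Dec (IsCut i k)
  isCut? i k with σ (lf i k)
  ... | nothing = no (λ ())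
  ... | just (x , false) = no (λ ())
  ... | just (x , true) = yes (x , refl)

  -- Here `(a , b)` is the completed pair of the matching edge at `nxt v`. At a cut leaf, `a`, `b`
  -- or `t` lies outside `Av v`, or `t` repeats `a` or `b`, so the outgoing edge saves a colour; at
  -- an uncut leaf `t` is the first colour again.
  Second : Fin s → Fin 4 → ℕ → Set
  Second i k t = let v = lf i k ; p = proj₁ (indep (kind-lf i k)) ; a = proj₁ (PM (nxt v) p) ; b = proj₂ (PM (nxt v) p) in
    t ∈ Lv v × t ≢ main i (sib k) × (IsCut i k → a ∉ Av v ⊎ b ∉ Av v ⊎ t ∉ Av v ⊎ t ≡ a ⊎ t ≡ b) ×
    (IsCut i k ⊎ t ≡ main i k)

  second : ∀ i k → ∃[ t ] Second i k t
  second i k with isCut? i k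
  ... | no ¬c = main i k , main-in i k , main-≢ i k , (λ c → ⊥-elim (¬c c)) , inj₂ refl
  ... | yes c with indep (kind-lf i k)
  -- The matching pair consists of two different colours, as `pick-near` requires; the first colour
  -- of the sibling is the forbidden one.
  ...   | p , kd with pick-near (main i (sib k)) _ _ (Lv-7 (lf i k)) (Av-7 (lf i k)) (proj₂ (proj₂ (PM-from kd)))
  ...     | t , t∈ , t≢ , near = t , t∈ , t≢ , (λ _ → near) , inj₁ c

  sec : Fin s → Fin 4 → ℕ
  sec i k = proj₁ (second i k)

  sec-uncut : ∀ i k → IsCut i k ⊎ sec i k ≡ main i k
  sec-uncut i k = proj₂ (proj₂ (proj₂ (proj₂ (second i k))))

  -- At most one leaf of each pair of siblings is cut; the lead is the one that may be.
  lead : ∀ i k → ∃[ c ] ((c ≡ k ⊎ c ≡ sib k) × sec i (sib c) ≡ main i (sib c))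
  lead i k with sec-uncut i k | sec-uncut i (sib k)
  ... | _ | inj₂ e = k , inj₁ refl , e
  ... | inj₂ e | inj₁ _ = sib k , inj₂ refl , subst (λ m → sec i m ≡ main i m) (≡-sym (sib-sib k)) e
  ... | inj₁ (_ , e) | inj₁ (_ , f) with cut-lf inv i k e
  ...   | _ , f′ , _ with trans (≡-sym f) f′
  ...     | ()

  Needs : Fin s → Fin 4 → List ℕ
  Needs i c = main i c ∷ main i (sib c) ∷ sec i c ∷ sec i (sib c) ∷ []

  Cover : Fin s → Fin 4 → Fin 4 → Set
  Cover i c d = ∃[ D ] (length D ≤ 5 × (∀ {z} → z ∈ Needs i c ++ Needs i d → z ∈ Kc i → z ∈ D))

  -- If one lead is uncut, its second colour is its first and at most five different colours are
  -- listed. If both are cut, `budget` replaces the four first colours by three, and the two second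
  -- colours make five.
  cover : ∀ i c d → c ≢ d → sec i (sib c) ≡ main i (sib c) → sec i (sib d) ≡ main i (sib d) → Cover i c d
  cover i c d c≢d e f with sec-uncut i c | sec-uncut i d
  ... | inj₂ g | _ = (main i c ∷ main i (sib c) ∷ main i d ∷ main i (sib d) ∷ sec i d ∷ []) , ≤-refl , λ
    { (here p) _ → here p ; (there (here p)) _ → there (here p)
    ; (there (there (here p))) _ → here (trans p g)
    ; (there (there (there (here p)))) _ → there (here (trans p e))
    ; (there (there (there (there (here p))))) _ → there (there (here p))
    ; (there (there (there (there (there (here p)))))) _ → there (there (there (here p)))
    ; (there (there (there (there (there (there (here p))))))) _ → there (there (there (there (here p))))
    ; (there (there (there (there (there (there (there (here p)))))))) _ → there (there (there (here (trans p f)))) }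
  ... | inj₁ _ | inj₂ g = (main i c ∷ main i (sib c) ∷ main i d ∷ main i (sib d) ∷ sec i c ∷ []) , ≤-refl , λ
    { (here p) _ → here p ; (there (here p)) _ → there (here p)
    ; (there (there (here p))) _ → there (there (there (there (here p))))
    ; (there (there (there (here p)))) _ → there (here (trans p e))
    ; (there (there (there (there (here p))))) _ → there (there (here p))
    ; (there (there (there (there (there (here p)))))) _ → there (there (there (here p)))
    ; (there (there (there (there (there (there (here p))))))) _ → there (there (here (trans p g)))
    ; (there (there (there (there (there (there (there (here p)))))))) _ → there (there (there (here (trans p f)))) }
  ... | inj₁ (x , g) | inj₁ (x′ , g′) with cut-lf inv i c g | cut-lf inv i d g′
  ...   | y , h , _ | y′ , h′ , _ with budget i c d c≢d g h g′ h′
  ...     | D , l , cov = (sec i c ∷ sec i d ∷ D) , s≤s (s≤s l) , λ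
    { (here p) z∈ → there (there (cov (here (trans p (main-just g))) z∈))
    ; (there (here p)) z∈ → there (there (cov (there (here (trans p (main-just h)))) z∈))
    ; (there (there (here p))) _ → here p
    ; (there (there (there (here p)))) z∈ → there (there (cov (there (here (trans p (trans e (main-just h))))) z∈))
    ; (there (there (there (there (here p))))) z∈ → there (there (cov (there (there (here (trans p (main-just g′))))) z∈))
    ; (there (there (there (there (there (here p)))))) z∈ →
        there (there (cov (there (there (there (here (trans p (main-just h′)))))) z∈))
    ; (there (there (there (there (there (there (here p))))))) _ → there (here p)
    ; (there (there (there (there (there (there (there (here p)))))))) z∈ →
        there (there (cov (there (there (there (here (trans p (trans f (main-just h′))))))) z∈)) }

  -- Pairs on a double-star

  record StarPairs (i : Fin s) : Set where
    field
      Q      : ℕ × ℕ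
      PL     : Fin 4 → ℕ × ℕ
      Q-from : PairFrom (Kc i) Q
      from   : ∀ k → PairFrom (Lv (lf i k)) (PL k)
      main∈  : ∀ k → main i k ∈₂ PL k
      sec∈   : ∀ k → sec i k ∈₂ PL k
      apart  : ∀ k → Disjoint₂ (PL k) (PL (sib k))
      Q#PL   : ∀ k → Disjoint₂ Q (PL k)

  -- The central pair `Q` is chosen first, off all prescribed leaf colours. The leaf pairs at the
  -- two centres do not meet and are then completed independently.
  starPairs : ∀ i → StarPairs i
  starPairs i with lead i #0 | lead i (fs (fs #0))
  ... | c , c≡ , c-main | d , d≡ , d-main with cover i c d (c≢d c≡ d≡) c-main d-main
    where
    c≢d : ∀ {c d} → c ≡ #0 ⊎ c ≡ fs #0 → d ≡ fs (fs #0) ⊎ d ≡ fs (fs (fs #0)) → c ≢ d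
    c≢d (inj₁ refl) (inj₁ refl) ()
    c≢d (inj₁ refl) (inj₂ refl) ()
    c≢d (inj₂ refl) (inj₁ refl) ()
    c≢d (inj₂ refl) (inj₂ refl) ()
  ...   | D , l , cov = record
    { Q = Q ; PL = PL ; Q-from = q₁∈ , q₂∈ , (λ e → q₂∉ (here (≡-sym e)))
    ; from = λ { #0 → A.fromA ; (fs #0) → A.fromB ; (fs (fs #0)) → B.fromA ; (fs (fs (fs #0))) → B.fromB }
    ; main∈ = λ { #0 → A.ma∈ ; (fs #0) → A.mb∈ ; (fs (fs #0)) → B.ma∈ ; (fs (fs (fs #0))) → B.mb∈ }
    ; sec∈ = λ { #0 → A.ta∈ ; (fs #0) → A.tb∈ ; (fs (fs #0)) → B.ta∈ ; (fs (fs (fs #0))) → B.tb∈ }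
    ; apart = λ { #0 → A.a#b ; (fs #0) p q → A.a#b q p ; (fs (fs #0)) → B.a#b ; (fs (fs (fs #0))) p q → B.a#b q p }
    ; Q#PL = λ { #0 → A.q#a ; (fs #0) → A.q#b ; (fs (fs #0)) → B.q#a ; (fs (fs (fs #0))) → B.q#b } }
    where
    -- The leaves need at most five of the seven central colours, so two are free for `Q`.
    first = pick D (Kc-7 i) (s≤s (≤-trans l (ℕₚ.n≤1+n 5)))
    q₁ = proj₁ first
    q₁∈ = proj₁ (proj₂ first)
    q₁∉ = proj₂ (proj₂ first)
    next′ = pick (q₁ ∷ D) (Kc-7 i) (s≤s (s≤s l))
    q₂ = proj₁ next′
    q₂∈ = proj₁ (proj₂ next′)
    q₂∉ = proj₂ (proj₂ next′)
    Q : ℕ × ℕ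
    Q = q₁ , q₂
    free : ∀ {z} → z ∈ Needs i c ++ Needs i d → ¬ z ∈₂ Q
    free z∈ (inj₁ refl) = q₁∉ (cov z∈ q₁∈)
    free z∈ (inj₂ refl) = q₂∉ (there (cov z∈ q₂∈))
    Pairs-at : Fin 4 → Set
    Pairs-at k = SiblingPairs Q (Lv (lf i k)) (Lv (lf i (sib k))) (main i k) (main i (sib k)) (sec i k) (sec i (sib k))
    -- In `sibling-pairs` the uncut leaf comes first, so it is applied to `sib c` and `c` and the
    -- outcome is swapped.
    leading : ∀ c → sec i (sib c) ≡ main i (sib c) → (∀ {z} → z ∈ Needs i c → ¬ z ∈₂ Q) → Pairs-at c
    leading c e fr = swap-siblings (subst (λ t → SiblingPairs Q (Lv (lf i (sib c))) (Lv (lf i c)) (main i (sib c)) (main i c) t (sec i c)) (≡-sym e)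
      (sibling-pairs Q (Lv-7 _) (Lv-7 _) (main-in i (sib c)) (main-in i c) (proj₁ (proj₂ (second i c)))
        (λ e → main-≢ i c (≡-sym e)) (proj₁ (proj₂ (proj₂ (second i c))))
        (fr (there (here refl))) (fr (here refl)) (fr (there (there (here refl))))))
    based : ∀ {k c} → c ≡ k ⊎ c ≡ sib k → Pairs-at c → Pairs-at k
    based (inj₁ refl) r = r
    based {k} (inj₂ refl) r = swap-siblings (subst
      (λ m → SiblingPairs Q (Lv (lf i (sib k))) (Lv (lf i m)) (main i (sib k)) (main i m) (sec i (sib k)) (sec i m))
      (sib-sib k) r)
    module A = SiblingPairs (based c≡ (leading c c-main (λ z∈ → free (∈-++⁺ˡ z∈))))
    module B = SiblingPairs (based d≡ (leading d d-main (λ z∈ → free (∈-++⁺ʳ (Needs i c) z∈))))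
    PL : Fin 4 → ℕ × ℕ
    PL #0 = A.Pa
    PL (fs #0) = A.Pb
    PL (fs (fs #0)) = B.Pa
    PL (fs (fs (fs #0))) = B.Pb

  module Star (i : Fin s) = StarPairs (starPairs i)

  pairOf : Fin n → Kind n s → ℕ × ℕ
  pairOf v (mat p) = PM v p
  pairOf v (pend i k) = Star.PL i k

  P : Fin n → ℕ × ℕ
  P v = pairOf v (kind v)

  P-mat : ∀ {v p} → kind v ≡ mat p → P v ≡ PM v p
  P-mat {v} kd = cong (pairOf v) kd

  P-pend : ∀ {v i k} → kind v ≡ pend i k → P v ≡ Star.PL i k
  P-pend {v} kd = cong (pairOf v) kd

  P-lf : ∀ i k → P (lf i k) ≡ Star.PL i k
  P-lf i k = P-pend (kind-lf i k)

  P-from : ∀ v → PairFrom (Lv v) (P v)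
  P-from v = go (kind v) refl
    where
    go : ∀ κ → kind v ≡ κ → PairFrom (Lv v) (P v)
    go (mat p) kd = subst (PairFrom (Lv v)) (≡-sym (P-mat kd)) (PM-from kd)
    go (pend i k) kd with lf-kind kd
    ... | refl = subst (PairFrom (Lv v)) (≡-sym (P-pend kd)) (Star.from i k)

  main∈P : ∀ {v i k} → kind v ≡ pend i k → main i k ∈₂ P v
  main∈P {v} {i} {k} kd = subst (main i k ∈₂_) (≡-sym (P-pend kd)) (Star.main∈ i k)

  coloured∈P : ∀ {v x b} → σ v ≡ just (x , b) → x ∈₂ P v
  coloured∈P {v} {x} e = go (kind v) refl
    where
    go : ∀ κ → kind v ≡ κ → x ∈₂ P v
    go (mat p) kd = subst (x ∈₂_) (≡-sym (P-mat kd)) (PM-left e)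
    go (pend i k) kd with lf-kind kd
    ... | refl = subst (_∈₂ P v) (main-just e) (main∈P kd)

  Keeps : Fin n → Set
  Keeps v = ∃[ p ] (p ∈₂ P v × (p ∉ Av v ⊎ p ∈₂ P (nxt v))) ⊎ ∃[ p ] (p ∈₂ P (nxt v) × p ∉ Av v)

  -- An uncut coloured vertex is served by `good`, a cut leaf by its second colour. A blank vertex
  -- and its successor have the same two least colours, and their pairs share one of these.
  keeps : ∀ v → Keeps v
  keeps v = go (σ v) refl (kind v) refl (kind (nxt v)) refl
    where
    served : ∀ {x y b u} → x ∈₂ P v → y ∈₂ P (nxt v) → σ u ≡ just (y , b) → y ∉ Av v ⊎ y ≡ x → Keeps v
    served x∈ y∈ _ (inj₁ y∉) = inj₂ (_ , y∈ , y∉)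
    served x∈ y∈ _ (inj₂ refl) = inj₁ (_ , x∈ , inj₂ y∈)
    inZ : ∀ {p} → σ v ≡ nothing → kind (nxt v) ≡ mat p → P (nxt v) ≡ (α v , β v)
    inZ {p} e kd = let _ , _ , f , g = stuck v e in
      trans (P-mat kd) (trans (PM-Z f (g p kd)) (≡-sym (αβ-nxt e)))
    go : ∀ m → σ v ≡ m → ∀ κ → kind v ≡ κ → ∀ κ′ → kind (nxt v) ≡ κ′ → Keeps v
    go (just (x , false)) e _ _ _ _ with good v e
    ... | inj₁ x∉ = inj₁ (x , coloured∈P e , inj₁ x∉)
    ... | inj₂ (inj₁ (y , b , f , r)) = served (coloured∈P e) (coloured∈P f) f r
    ... | inj₂ (inj₂ (p , kd , y , b , f , r)) =
          served (coloured∈P e) (subst (y ∈₂_) (≡-sym (P-mat kd)) (PM-right f)) f r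
    go (just (x , true)) e (mat p) kd _ _ with cut v e
    ... | _ , _ , _ , kd′ , _ with trans (≡-sym kd) kd′
    ...   | ()
    go (just (x , true)) e (pend i k) kd _ _ with lf-kind kd
    ... | refl = near (proj₁ (proj₂ (proj₂ (proj₂ (second i k)))) (x , e))
      where
      p = proj₁ (indep (kind-lf i k))
      P≡ : P (nxt v) ≡ PM (nxt v) p
      P≡ = P-mat (proj₂ (indep (kind-lf i k)))
      here₂ : ∀ {z} → z ∈₂ PM (nxt v) p → z ∈₂ P (nxt v)
      here₂ {z} = subst (z ∈₂_) (≡-sym P≡)
      t∈ : sec i k ∈₂ P v
      t∈ = subst (sec i k ∈₂_) (≡-sym (P-pend kd)) (Star.sec∈ i k)
      near : proj₁ (PM (nxt v) p) ∉ Av v ⊎ proj₂ (PM (nxt v) p) ∉ Av v ⊎ sec i k ∉ Av v ⊎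
             sec i k ≡ proj₁ (PM (nxt v) p) ⊎ sec i k ≡ proj₂ (PM (nxt v) p) → Keeps v
      near (inj₁ a∉) = inj₂ (_ , here₂ (inj₁ refl) , a∉)
      near (inj₂ (inj₁ b∉)) = inj₂ (_ , here₂ (inj₂ refl) , b∉)
      near (inj₂ (inj₂ (inj₁ t∉))) = inj₁ (_ , t∈ , inj₁ t∉)
      near (inj₂ (inj₂ (inj₂ t≡))) = inj₁ (_ , t∈ , inj₂ (here₂ t≡))
    go nothing e (mat q) kd (mat p) kd′ = inj₁ (α v , subst (α v ∈₂_) (≡-sym (P-mat kd)) (PM-half (inj₁ refl)
      (≡-sym (trans (mcol-nothing e) (cong (fallback v) kd′)))) , inj₂ (subst (α v ∈₂_) (≡-sym (inZ e kd′)) (inj₁ refl)))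
    go nothing e (pend i k) kd (mat p) kd′ with lf-kind kd
    ... | refl = inj₁ (main i k , main∈P kd , inj₂ (subst (main i k ∈₂_) (≡-sym (inZ e kd′)) (main-Z e)))
    go nothing e (mat q) kd (pend i k) kd′ = inj₁ (main i k , subst (main i k ∈₂_) (≡-sym (P-mat kd))
      (PM-half (nxt-leaf-in e kd′) (≡-sym (trans (mcol-nothing e) (cong (fallback v) kd′)))) , inj₂ (main∈P kd′))
    -- Two leaves never follow each other on a cycle.
    go nothing e (pend i k) kd (pend j l) kd′ with indep kd
    ... | p , kd″ with trans (≡-sym kd″) kd′
    ...   | ()

  solution : Solution I
  solution = record
    { P = P ; Q = Star.Q ; P-from = P-from ; Q-from = Star.Q-from
    ; P-mat = λ {v} {p} {z} kd z∈ → subst (z ∈₂_) (≡-sym (P-mat (proj₁ (partner kd))))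
                (PM-comm kd (subst (z ∈₂_) (P-mat kd) z∈))
    ; P-sib = λ i k {z} p q → Star.apart i k (subst (z ∈₂_) (P-lf i k) p) (subst (z ∈₂_) (P-lf i (sib k)) q)
    ; P-Q = λ i k {z} p q → Star.Q#PL i k p (subst (z ∈₂_) (P-lf i k) q)
    ; keeps = keeps }

solve : ∀ {n s} (I : Instance n s) → Solution I
solve I = let σ , inv , stuck = Saturation.saturated I in Pairs.solution I σ inv stuck

-- Cyclic successors

next-step : ∀ j t → suc (toℕ t) < cycLen j → toℕ (next j t) ≡ suc (toℕ t)
next-step j t lt = trans (Finₚ.toℕ-fromℕ< _) (m<n⇒m%n≡m lt)

next-wrap : ∀ j t → suc (toℕ t) ≡ cycLen j → toℕ (next j t) ≡ 0
next-wrap j t e = trans (Finₚ.toℕ-fromℕ< _) (trans (cong (_% cycLen j) e) (n%n≡0 (cycLen j)))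

next-cases : ∀ j t → suc (toℕ t) < cycLen j ⊎ suc (toℕ t) ≡ cycLen j
next-cases j t = ℕₚ.m≤n⇒m<n∨m≡n (Finₚ.toℕ<n t)

-- Conjugation by `opposite` inverts `next`; predecessors, injectivity and the reversal of cycles
-- all rest on this.
next-opposite : ∀ j t → next j (opposite (next j t)) ≡ opposite t
next-opposite j t with next-cases j t
... | inj₁ lt = Finₚ.toℕ-injective (trans (next-step j _ small) (trans up (≡-sym (Finₚ.opposite-prop t))))
  where
  up : suc (toℕ (opposite (next j t))) ≡ cycLen j ∸ suc (toℕ t)
  up = trans (cong suc (trans (Finₚ.opposite-prop (next j t)) (cong (λ m → cycLen j ∸ suc m) (next-step j t lt))))
         (≡-sym (ℕₚ.+-∸-assoc 1 lt))
  small : suc (toℕ (opposite (next j t))) < cycLen j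
  small = subst (_< cycLen j) (≡-sym up) (s≤s (ℕₚ.m∸n≤m _ (toℕ t)))
... | inj₂ e = Finₚ.toℕ-injective (trans (next-wrap j _ up)
        (≡-sym (trans (Finₚ.opposite-prop t) (trans (cong (cycLen j ∸_) e) (ℕₚ.n∸n≡0 (cycLen j))))))
  where
  up : suc (toℕ (opposite (next j t))) ≡ cycLen j
  up = cong suc (trans (Finₚ.opposite-prop (next j t)) (cong (λ m → cycLen j ∸ suc m) (next-wrap j t e)))

prev : ∀ j → Fin (cycLen j) → Fin (cycLen j)
prev j t = opposite (next j (opposite t))

next-prev : ∀ j t → next j (prev j t) ≡ t
next-prev j t = trans (next-opposite j (opposite t)) (Finₚ.opposite-involutive t)

next-injective : ∀ j {t u} → next j t ≡ next j u → t ≡ u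
next-injective j {t} {u} e = trans (≡-sym (back t)) (trans (cong (opposite ∘ next j ∘ opposite) e) (back u))
  where
  back : ∀ t → opposite (next j (opposite (next j t))) ≡ t
  back t = trans (cong opposite (next-opposite j t)) (Finₚ.opposite-involutive t)

-- Cycles have length at least four; this keeps the two cycle edges at a vertex distinct.
next-next-≢ : ∀ j t → next j (next j t) ≢ t
next-next-≢ j t e with next-cases j t
... | inj₂ w with trans (≡-sym w) (cong (suc ∘ toℕ) (≡-sym e))
...   | q rewrite next-step j (next j t) (subst (λ m → suc m < cycLen j) (≡-sym (next-wrap j t w)) (s≤s (s≤s z≤n)))
            | next-wrap j t w with q
...     | ()
next-next-≢ j t e | inj₁ lt with next-cases j (next j t)
... | inj₁ lt′ = ℕₚ.<-irrefl (≡-sym (cong toℕ e)) (subst (toℕ t <_)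
        (≡-sym (trans (next-step j _ lt′) (cong suc (next-step j t lt)))) (s≤s (ℕₚ.n≤1+n _)))
... | inj₂ w with trans (≡-sym w) (cong suc (next-step j t lt))
...   | q rewrite trans (cong toℕ (≡-sym e)) (next-wrap j _ w) with q
...     | ()

isOdd : ℕ → Bool
isOdd zero = false
isOdd (suc m) = not (isOdd m)

isOdd-double : ∀ m → isOdd (m + m) ≡ false
isOdd-double zero = refl
isOdd-double (suc m) = trans (cong (not ∘ isOdd) (ℕₚ.+-suc m m)) (trans (not-involutive _) (isOdd-double m))

-- At the wrap-around this needs the length to be even: the last index is odd and is followed by 0.
isOdd-next : ∀ j t → isOdd (toℕ (next j t)) ≡ not (isOdd (toℕ t))
isOdd-next j t with next-cases j t
... | inj₁ lt = cong isOdd (next-step j t lt)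
... | inj₂ e = trans (cong isOdd (next-wrap j t e)) (≡-sym (trans (cong isOdd e) even))
  where
  even : isOdd (cycLen j) ≡ false
  even = trans (not-involutive _) (trans (not-involutive _)
           (trans (cong (λ m → isOdd (j + m)) (ℕₚ.+-identityʳ j)) (isOdd-double j)))

-- Climb from `t` to the last index, wrap to 0, and climb to `u`.
next-reaches : ∀ j (Z : Fin (cycLen j) → Set) → (∀ t → Z t → Z (next j t)) → ∀ t u → Z t → Z u
next-reaches j Z closed t u z = climb (toℕ u) origin u refl (subst Z wrap (closed last
    (climb (cycLen j ∸ 1 ∸ toℕ t) t last (trans (Finₚ.opposite-prop {cycLen j} #0)
      (≡-sym (ℕₚ.m+[n∸m]≡n (ℕₚ.≤-pred (Finₚ.toℕ<n t))))) z)))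
  where
  last : Fin (cycLen j)
  last = opposite #0
  origin : Fin (cycLen j)
  origin = #0
  wrap : next j last ≡ origin
  wrap = Finₚ.toℕ-injective (next-wrap j last (cong suc (Finₚ.opposite-prop {cycLen j} #0)))
  climb : ∀ d t u → toℕ u ≡ toℕ t + d → Z t → Z u
  climb 0 t u e z = subst Z (Finₚ.toℕ-injective (≡-sym (trans e (ℕₚ.+-identityʳ _)))) z
  climb (suc d) t u e z = climb d (next j t) u (trans e′ (cong (_+ d) (≡-sym (next-step j t lt)))) (closed t z)
    where
    e′ : toℕ u ≡ suc (toℕ t) + d
    e′ = trans e (ℕₚ.+-suc (toℕ t) d)
    lt : suc (toℕ t) < cycLen j
    lt = ℕₚ.≤-<-trans (ℕₚ.m≤m+n _ d) (subst (_< cycLen j) e′ (Finₚ.toℕ<n u))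

-- Edges and degrees

module _ {n : ℕ} {G : Graph n} where

  edge-≡ : {e f : Edge G} → x e ≡ x f → y e ≡ y f → e ≡ f
  edge-≡ {edge a b l t} {edge _ _ l′ t′} refl refl = cong₂ (edge a b) (ℕₚ.<-irrelevant l l′) (T-irrelevant t t′)

  _≟ₑ_ : DecidableEquality (Edge G)
  e ≟ₑ f with x e Finₚ.≟ x f | y e Finₚ.≟ y f
  ... | yes p | yes q = yes (edge-≡ p q)
  ... | no ¬p | _ = no (λ r → ¬p (cong x r))
  ... | yes _ | no ¬q = no (λ r → ¬q (cong y r))

  joins-self : (e : Edge G) → Joins e (x e) (y e)
  joins-self e = inj₁ (refl , refl)

  joins-sym : (e : Edge G) {a b : Fin n} → Joins e a b → Joins e b a
  joins-sym _ (inj₁ (p , q)) = inj₂ (p , q)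
  joins-sym _ (inj₂ (p , q)) = inj₁ (p , q)

  joins-match : (e : Edge G) {a b c d : Fin n} → Joins e a b → Joins e c d → (a ≡ c × b ≡ d) ⊎ (a ≡ d × b ≡ c)
  joins-match _ (inj₁ (refl , refl)) (inj₁ (refl , refl)) = inj₁ (refl , refl)
  joins-match _ (inj₁ (refl , refl)) (inj₂ (refl , refl)) = inj₂ (refl , refl)
  joins-match _ (inj₂ (refl , refl)) (inj₁ (refl , refl)) = inj₂ (refl , refl)
  joins-match _ (inj₂ (refl , refl)) (inj₂ (refl , refl)) = inj₁ (refl , refl)

  joins-unique : {e f : Edge G} {a b : Fin n} → Joins e a b → Joins f a b → e ≡ f
  joins-unique (inj₁ (p , q)) (inj₁ (p′ , q′)) = edge-≡ (trans p (≡-sym p′)) (trans q (≡-sym q′))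
  joins-unique (inj₂ (p , q)) (inj₂ (p′ , q′)) = edge-≡ (trans p (≡-sym p′)) (trans q (≡-sym q′))
  joins-unique {e} {f} (inj₁ (refl , refl)) (inj₂ (p , q)) =
    ⊥-elim (ℕₚ.<-asym (x<y e) (subst (λ u → toℕ u < toℕ (x e)) p (subst (λ u → toℕ (x f) < toℕ u) q (x<y f))))
  joins-unique {e} {f} (inj₂ (p , q)) (inj₁ (refl , refl)) =
    ⊥-elim (ℕₚ.<-asym (x<y f) (subst (λ u → toℕ u < toℕ (x f)) p (subst (λ u → toℕ (x e) < toℕ u) q (x<y e))))

  joins-adj : (e : Edge G) {a b : Fin n} → Joins e a b → T (adj G a b)
  joins-adj e (inj₁ (refl , refl)) = xy e
  joins-adj e (inj₂ (refl , refl)) = subst T (sym G (x e) (y e)) (xy e)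

  adj-≢ : {a b : Fin n} → T (adj G a b) → a ≢ b
  adj-≢ {a} t refl = subst T (irrefl G a) t

  joins-other : {e f : Edge G} {v a b : Fin n} → Joins e v a → Joins f v b → e ≢ f → a ≢ b
  joins-other j j′ e≢f refl = e≢f (joins-unique j j′)

  joins-end : (e : Edge G) {v a b : Fin n} → Joins e v a → Joins e v b → a ≡ b
  joins-end e j j′ with joins-match e j j′
  ... | inj₁ (_ , q) = q
  ... | inj₂ (p , q) = trans q p

  abstract
    joining : {a b : Fin n} → T (adj G a b) → ∃[ e ] Joins {G = G} e a b
    joining {a} {b} t with ℕₚ.<-cmp (toℕ a) (toℕ b)
    ... | tri< lt _ _ = edge a b lt t , inj₁ (refl , refl)
    ... | tri≈ _ e _ = ⊥-elim (adj-≢ t (Finₚ.toℕ-injective e))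
    ... | tri> _ _ gt = edge b a gt (subst T (sym G a b) t) , inj₂ (refl , refl)

  incident-at : {e f : Edge G} → Incident e f →
                e ≢ f × ∃[ v ] ∃[ a ] ∃[ b ] (Joins e v a × Joins f v b)
  incident-at {e} {f} (d , s) = (λ { refl → d refl }) , shared s
    where
    shared : x e ≡ x f ⊎ x e ≡ y f ⊎ y e ≡ x f ⊎ y e ≡ y f → ∃[ v ] ∃[ a ] ∃[ b ] (Joins e v a × Joins f v b)
    shared (inj₁ p) = x e , y e , y f , inj₁ (refl , refl) , inj₁ (≡-sym p , refl)
    shared (inj₂ (inj₁ p)) = x e , y e , x f , inj₁ (refl , refl) , inj₂ (refl , ≡-sym p)
    shared (inj₂ (inj₂ (inj₁ p))) = y e , x e , y f , inj₂ (refl , refl) , inj₁ (≡-sym p , refl)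
    shared (inj₂ (inj₂ (inj₂ p))) = y e , x e , x f , inj₂ (refl , refl) , inj₂ (refl , ≡-sym p)

  at-incident : {e f : Edge G} {v a b : Fin n} → Joins e v a → Joins f v b → e ≢ f → Incident e f
  at-incident {e} {f} j j′ e≢f = (λ p → e≢f (edge-≡ (cong proj₁ p) (cong proj₂ p))) , shared j j′
    where
    shared : ∀ {v a b} → Joins e v a → Joins f v b → x e ≡ x f ⊎ x e ≡ y f ⊎ y e ≡ x f ⊎ y e ≡ y f
    shared (inj₁ (p , _)) (inj₁ (q , _)) = inj₁ (trans p (≡-sym q))
    shared (inj₁ (p , _)) (inj₂ (_ , q)) = inj₂ (inj₁ (trans p (≡-sym q)))
    shared (inj₂ (_ , p)) (inj₁ (q , _)) = inj₂ (inj₂ (inj₁ (trans p (≡-sym q))))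
    shared (inj₂ (_ , p)) (inj₂ (_ , q)) = inj₂ (inj₂ (inj₂ (trans p (≡-sym q))))

neighbours : ∀ {n} → Graph n → Fin n → List (Fin n)
neighbours {n} G u = filter (λ v → T? (adj G u v)) (allFin n)

degree-length : ∀ {n} (G : Graph n) u → degree G u ≡ length (neighbours G u)
degree-length {n} G u = go (allFin n)
  where
  go : ∀ vs → sum (map (λ v → if adj G u v then 1 else 0) vs) ≡ length (filter (λ v → T? (adj G u v)) vs)
  go [] = refl
  go (v ∷ vs) with adj G u v
  ... | true = cong suc (go vs)
  ... | false = go vs

module _ {n : ℕ} {G : Graph n} (reg : Regular 3 G) where

  three : ∀ u → length (neighbours G u) ≡ 3
  three u = trans (≡-sym (degree-length G u)) (reg u)

  no-four : ∀ {u vs} → Unique vs → (∀ {v} → v ∈ vs → T (adj G u v)) → length vs ≡ 4 → ⊥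
  no-four {u} {vs} uniq adjacent l = ℕₚ.<-irrefl {3} refl (≤-trans (≤-reflexive (≡-sym l))
    (≤-trans (pigeonhole uniq (λ v∈ → ∈-filter⁺ (λ v → T? (adj G u v)) (∈-allFin _) (adjacent v∈)))
      (≤-reflexive (three u))))

  another : ∀ u vs → length vs < 3 → ∃[ e ] ∃[ w ] (Joins {G = G} e u w × w ∉ vs)
  another u vs lt with avoiding Finₚ._≟_ {ys = vs} (Uniqueₚ.filter⁺ (λ v → T? (adj G u v)) (Uniqueₚ.allFin⁺ n))
                         (≤-trans lt (≤-reflexive (≡-sym (three u))))
  ... | w , w∈ , w∉ = let e , j = joining (proj₂ (∈-filter⁻ (λ v → T? (adj G u v)) {xs = allFin n} w∈))
                      in e , w , j , w∉

  no-four-edges : ∀ {u a b c d} (e f g h : Edge G) → Joins e u a → Joins f u b → Joins g u c → Joins h u d →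
                  Unique (e ∷ f ∷ g ∷ h ∷ []) → ⊥
  no-four-edges {u} {a} {b} {c} {d} e f g h je jf jg jh
    ((e≢f ∷ e≢g ∷ e≢h ∷ []) ∷ (f≢g ∷ f≢h ∷ []) ∷ (g≢h ∷ []) ∷ _) = no-four {u} {a ∷ b ∷ c ∷ d ∷ []}
    ((joins-other je jf e≢f ∷ joins-other je jg e≢g ∷ joins-other je jh e≢h ∷ []) ∷
     (joins-other jf jg f≢g ∷ joins-other jf jh f≢h ∷ []) ∷ (joins-other jg jh g≢h ∷ []) ∷ [] ∷ [])
    (λ { (here refl) → joins-adj {G = G} e je ; (there (here refl)) → joins-adj {G = G} f jf ; (there (there (here refl))) → joins-adj {G = G} g jg
       ; (there (there (there (here refl)))) → joins-adj {G = G} h jh }) refl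

-- Reversing a cycle

reverse : ∀ {n} {G : Graph n} → EvenCycle G → EvenCycle G
reverse {G = G} C = record
  { half = half C
  ; vert = vert C ∘ opposite
  ; vinj = λ e → trans (≡-sym (Finₚ.opposite-involutive _)) (trans (cong opposite (vinj C e)) (Finₚ.opposite-involutive _))
  ; vadj = λ t → subst T (sym G _ _) (subst (λ u → T (adj G (vert C (opposite (next (half C) t))) (vert C u)))
             (next-opposite (half C) t) (vadj C (opposite (next (half C) t)))) }

reverse-on : ∀ {n} {G : Graph n} (C : EvenCycle G) (e : Edge G) → OnCycle C e → OnCycle (reverse C) e
reverse-on C e (t , j) = opposite (next (half C) t) ,
  subst₂ (Joins e) (cong (vert C) (≡-sym (Finₚ.opposite-involutive _)))
    (cong (vert C) (≡-sym (trans (cong opposite (next-opposite (half C) t)) (Finₚ.opposite-involutive _)))) (joins-sym e j)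

reverse-joins : ∀ {n} {G : Graph n} (C : EvenCycle G) (e : Edge G) t →
  Joins e (vert (reverse C) t) (vert (reverse C) (next (half C) t)) →
  let u = opposite (next (half C) t) in Joins e (vert C u) (vert C (next (half C) u))
reverse-joins C e t j = subst (λ u → Joins e (vert C (opposite (next (half C) t))) (vert C u)) (≡-sym (next-opposite (half C) t)) (joins-sym e j)

reverse-off : ∀ {n} {G : Graph n} (C : EvenCycle G) (e : Edge G) → OnCycle (reverse C) e → OnCycle C e
reverse-off C e (t , j) = opposite (next (half C) t) , reverse-joins C e t j

cycleEdge : ∀ {n} {G : Graph n} (C : EvenCycle G) t → ∃[ e ] Joins {G = G} e (vert C t) (vert C (next (half C) t))
cycleEdge C t = joining (vadj C t)

-- Leaves and centres of the standard double-star

centre : Fin 4 → Fin 6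
centre k = proj₁ (dsEdge (fs k))

leaf-not-first : ∀ k m → leaf k ≢ proj₁ (dsEdge m)
leaf-not-first = from-yes (Finₚ.all? λ k → Finₚ.all? λ m → ¬? (leaf k Finₚ.≟ proj₁ (dsEdge m)))

leaf-second : ∀ k m → leaf k ≡ proj₂ (dsEdge m) → m ≡ fs k
leaf-second = from-yes (Finₚ.all? λ k → Finₚ.all? λ m → (leaf k Finₚ.≟ proj₂ (dsEdge m)) →-dec (m Finₚ.≟ fs k))

same-centre : ∀ k l → centre k ≡ centre l → l ≡ k ⊎ l ≡ sib k
same-centre = from-yes (Finₚ.all? λ k → Finₚ.all? λ l →
  (centre k Finₚ.≟ centre l) →-dec ((l Finₚ.≟ k) ⊎-dec (l Finₚ.≟ sib k)))

dsEdge-leaf : ∀ k → dsEdge (fs k) ≡ (centre k , leaf k)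
dsEdge-leaf #0 = refl
dsEdge-leaf (fs #0) = refl
dsEdge-leaf (fs (fs #0)) = refl
dsEdge-leaf (fs (fs (fs #0))) = refl

-- Reading kinds and lists of vertices off the decomposition

module Decomposition {n : ℕ} {G : Graph n} (reg : Regular 3 G) (π : Edge G → Fin 3) (matching : IsMatchingPart π)
  (stars : IsIndepDoubleStarsPart π) (L : Edge G → Fin 7 → ℕ) (L-inj : ∀ e → Injective _≡_ _≡_ (L e)) where

  lst : Edge G → List ℕ
  lst e = tabulate (L e)

  lst-7 : ∀ e → Seven (lst e)
  lst-7 e = Uniqueₚ.tabulate⁺ (L-inj e) , length-tabulate (L e)

  s : ℕ
  s = proj₁ stars

  D : Fin s → DoubleStar G
  D = proj₁ (proj₂ stars)

  D-on : ∀ e i → OnDoubleStar (D i) e → π e ≡ part2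
  D-on = proj₂ (proj₂ (proj₂ (proj₂ (proj₂ stars))))

  D-covers : ∀ e → π e ≡ part2 → ∃[ i ] OnDoubleStar (D i) e
  D-covers = proj₁ (proj₂ (proj₂ (proj₂ (proj₂ stars))))

  lf : Fin s → Fin 4 → Fin n
  lf i k = dv (D i) (leaf k)

  leaves-apart : ∀ i j k l → T (adj G (lf i k) (lf j l)) → ⊥
  leaves-apart i j k l t = subst T (proj₁ (proj₂ (proj₂ (proj₂ stars))) i j k l) t

  dv-injective : ∀ {i j a b} → dv (D i) a ≡ dv (D j) b → i ≡ j × a ≡ b
  dv-injective {i} {j} {a} {b} e with i Finₚ.≟ j
  ... | yes refl = refl , dinj (D i) e
  ... | no i≢j = ⊥-elim (proj₁ (proj₂ (proj₂ stars)) i j a b i≢j e)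

  parts-≢ : ∀ {e f : Edge G} {a b} → π e ≡ a → π f ≡ b → a ≢ b → e ≢ f
  parts-≢ p q a≢b refl = a≢b (trans (≡-sym p) q)

  starEdge : ∀ i m → ∃[ e ] (Joins {G = G} e (dv (D i) (proj₁ (dsEdge m))) (dv (D i) (proj₂ (dsEdge m))) × π e ≡ part2)
  starEdge i m = let e , j = joining (dadj (D i) m) in e , j , D-on e i (m , j)

  leafEdge : ∀ i k → ∃[ e ] (Joins {G = G} e (lf i k) (dv (D i) (centre k)) × π e ≡ part2)
  leafEdge i k = let e , j , p = starEdge i (fs k) in
    e , joins-sym e (subst (λ q → Joins e (dv (D i) (proj₁ q)) (dv (D i) (proj₂ q))) (dsEdge-leaf k) j) , p

  -- Different stars are disjoint, and within its own star a leaf lies on a single edge.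
  leaf-part2 : ∀ {e i k w} → Joins e (lf i k) w → π e ≡ part2 → e ≡ proj₁ (leafEdge i k)
  leaf-part2 {e} {i} {k} j p with D-covers e p
  ... | i′ , m , j′ with joins-match e j j′
  ...   | inj₁ (q , _) = ⊥-elim (leaf-not-first k m (proj₂ (dv-injective q)))
  ...   | inj₂ (q , _) with dv-injective q
  ...     | refl , r with leaf-second k m r
  ...       | refl = joins-unique (subst (λ q → Joins e (dv (D i) (proj₁ q)) (dv (D i) (proj₂ q))) (dsEdge-leaf k) j′)
                       (joins-sym (proj₁ (leafEdge i k)) (proj₁ (proj₂ (leafEdge i k))))

  data Centre : Fin 6 → Set where
    first  : Centre #0
    second : Centre (fs #0)

  centre-Centre : ∀ k → Centre (centre k)
  centre-Centre #0 = first
  centre-Centre (fs #0) = first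
  centre-Centre (fs (fs #0)) = second
  centre-Centre (fs (fs (fs #0))) = second

  -- The three star edges at a centre exhaust its degree.
  centre-full : ∀ {e i c w} → Centre c → Joins e (dv (D i) c) w → π e ≢ part2 → ⊥
  centre-full {e} {i} ctr j ne = go ctr j
    where
    Star : Fin 6 → Fin 6 → Set
    Star c a = ∃[ f ] (Joins {G = G} f (dv (D i) c) (dv (D i) a) × π f ≡ part2)
    full : ∀ {c a b d w} → a ≢ b → a ≢ d → b ≢ d → Star c a → Star c b → Star c d → Joins e (dv (D i) c) w → ⊥
    full {c} a≢b a≢d b≢d (fa , ja , pa) (fb , jb , pb) (fd , jd , pd) j = no-four-edges reg e fa fb fd j ja jb jd
      ((e≢ pa ∷ e≢ pb ∷ e≢ pd ∷ []) ∷ (f≢ a≢b ja jb ∷ f≢ a≢d ja jd ∷ []) ∷ (f≢ b≢d jb jd ∷ []) ∷ [] ∷ [])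
      where
      e≢ : ∀ {f} → π f ≡ part2 → e ≢ f
      e≢ p refl = ne p
      f≢ : ∀ {f g a b} → a ≢ b → Joins {G = G} f (dv (D i) c) (dv (D i) a) → Joins {G = G} g (dv (D i) c) (dv (D i) b) → f ≢ g
      f≢ {f} a≢b j j′ refl = a≢b (dinj (D i) (joins-end f j j′))
    flip : ∀ {c a} → Star c a → Star a c
    flip (f , j , p) = f , joins-sym f j , p
    go : ∀ {c w} → Centre c → Joins e (dv (D i) c) w → ⊥
    go first = full (λ ()) (λ ()) (λ ()) (starEdge i #0) (starEdge i (fs #0)) (starEdge i (fs (fs #0)))
    go second = full (λ ()) (λ ()) (λ ()) (flip (starEdge i #0)) (starEdge i (fs (fs (fs #0)))) (starEdge i (fs (fs (fs (fs #0)))))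

  Matched : Fin n → Fin n → Set
  Matched v p = ∃[ e ] (Joins {G = G} e v p × π e ≡ #0)

  matched? : ∀ v p → Dec (Matched v p)
  matched? v p with T? (adj G v p)
  ... | no ¬t = no (λ { (e , j , _) → ¬t (joins-adj e j) })
  ... | yes t with joining t
  ...   | e , j with π e Finₚ.≟ #0
  ...     | yes q = yes (e , j , q)
  ...     | no ¬q = no (λ { (f , j′ , q) → ¬q (subst (λ g → π g ≡ #0) (joins-unique j′ j) q) })

  matched-unique : ∀ {v p q} (m : Matched v p) (m′ : Matched v q) → proj₁ m ≡ proj₁ m′ × p ≡ q
  matched-unique (e , j , r) (f , j′ , r′) with e ≟ₑ f
  ... | yes refl = refl , joins-end e j j′
  ... | no e≢f = ⊥-elim (matching e f r r′ (at-incident {e = e} {f} j j′ e≢f))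

  matched-sym : ∀ {v p} → Matched v p → Matched p v
  matched-sym (e , j , q) = e , joins-sym e j , q

  data Class (v : Fin n) : Set where
    matched : ∀ p → Matched v p → Class v
    leafy   : (∀ p → ¬ Matched v p) → ∀ i k → v ≡ lf i k → Class v
    bare    : (∀ p → ¬ Matched v p) → (∀ i k → v ≢ lf i k) → Class v

  abstract
    classify : ∀ v → Class v
    classify v with Finₚ.any? (matched? v)
    ... | yes (p , m) = matched p m
    ... | no ¬m with Finₚ.any? (λ i → Finₚ.any? (λ k → v Finₚ.≟ lf i k))
    ...   | yes (i , k , q) = leafy (λ p m → ¬m (p , m)) i k q
    ...   | no ¬l = bare (λ p m → ¬m (p , m)) (λ i k q → ¬l (i , k , q))

  -- A bare vertex, such as the centre of a star, counts as its own partner and in `listOf` receives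
  -- a dummy list of seven colours, so that every vertex has a kind and a list.
  kindOf : ∀ {v} → Class v → Kind n s
  kindOf (matched p _) = mat p
  kindOf (leafy _ i k _) = pend i k
  kindOf {v} (bare _ _) = mat v

  listOf : ∀ {v} → Class v → List ℕ
  listOf (matched _ (e , _)) = lst e
  listOf (leafy _ i k _) = lst (proj₁ (leafEdge i k))
  listOf (bare _ _) = upTo 7

  listOf-7 : ∀ {v} (c : Class v) → Seven (listOf c)
  listOf-7 (matched _ (e , _)) = lst-7 e
  listOf-7 (leafy _ i k _) = lst-7 (proj₁ (leafEdge i k))
  listOf-7 (bare _ _) = Uniqueₚ.upTo⁺ 7 , refl

  kind : Fin n → Kind n s
  kind v = kindOf (classify v)

  Lv : Fin n → List ℕ
  Lv v = listOf (classify v)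

  class-matched : ∀ {v p} (m : Matched v p) → kind v ≡ mat p × Lv v ≡ lst (proj₁ m)
  class-matched {v} {p} m with classify v
  ... | matched q m′ with matched-unique m m′
  ...   | e , refl = refl , cong lst (≡-sym e)
  class-matched {v} {p} m | leafy ¬m _ _ _ = ⊥-elim (¬m p m)
  class-matched {v} {p} m | bare ¬m _ = ⊥-elim (¬m p m)

  partner : ∀ {v p} → kind v ≡ mat p → kind p ≡ mat v × Lv p ≡ Lv v
  partner {v} {p} kd = go (classify v) refl
    where
    go : ∀ c → classify v ≡ c → kind p ≡ mat v × Lv p ≡ Lv v
    go (matched q m) e with trans (≡-sym (cong kindOf e)) kd
    ... | refl = let k , l = class-matched (matched-sym m) in k , trans l (≡-sym (cong listOf e))
    go (leafy _ _ _ _) e with trans (≡-sym (cong kindOf e)) kd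
    ... | ()
    go (bare _ _) e with trans (≡-sym (cong kindOf e)) kd
    ... | refl = kd , refl

  lf-kind : ∀ {v i k} → kind v ≡ pend i k → v ≡ lf i k
  lf-kind {v} kd with classify v
  lf-kind refl | leafy _ i k e = e

  -- If every vertex list is contained in (hence equals) the list of the outgoing edge, then reversing the
  -- cycle makes each edge list equal to the list of the vertex it leads to.

  Tilted : EvenCycle G → Set
  Tilted C = ∃[ t ] ¬ (Lv (vert C t) ⊆ lst (proj₁ (cycleEdge C t)))

  Flat : EvenCycle G → Set
  Flat C = ∀ t → lst (proj₁ (cycleEdge C t)) ⊆ Lv (vert C (next (half C) t))

  record Oriented (C : EvenCycle G) : Set where
    field
      C′    : EvenCycle G
      on    : ∀ e → OnCycle C e → OnCycle C′ e
      off   : ∀ e → OnCycle C′ e → OnCycle C e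
      same  : ∀ t → ∃[ u ] vert C′ t ≡ vert C u
      shape : Tilted C′ ⊎ Flat C′

  orient : ∀ C → Oriented C
  orient C with Finₚ.any? (λ t → ¬? (⊆? (Lv (vert C t)) (lst (proj₁ (cycleEdge C t)))))
    where
    ⊆? : ∀ xs ys → Dec (xs ⊆ ys)
    ⊆? xs ys with All.all? (_∈? ys) xs
    ... | yes a = yes (All.lookup a)
    ... | no ¬a = no (λ sub → ¬a (All.tabulate sub))
  ... | yes tilted = record { C′ = C ; on = λ _ o → o ; off = λ _ o → o ; same = λ t → t , refl ; shape = inj₁ tilted }
  ... | no ¬tilted = record
    { C′ = reverse C ; on = reverse-on C ; off = reverse-off C ; same = λ t → opposite t , refl ; shape = inj₂ flat }
    where
    flat : Flat (reverse C)
    flat t {z} z∈ = ⊆-reverse (listOf-7 (classify (vert C u))) (lst-7 (proj₁ (cycleEdge C u))) sub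
                      (subst (λ e → z ∈ lst e) same z∈)
      where
      u = opposite (next (half C) t)
      same : proj₁ (cycleEdge (reverse C) t) ≡ proj₁ (cycleEdge C u)
      same = joins-unique (reverse-joins C (proj₁ (cycleEdge (reverse C) t)) t (proj₂ (cycleEdge (reverse C) t)))
               (proj₂ (cycleEdge C u))
      sub : Lv (vert C u) ⊆ lst (proj₁ (cycleEdge C u))
      sub {w} w∈ with w ∈? lst (proj₁ (cycleEdge C u))
      ... | yes w∈A = w∈A
      ... | no w∉A = ⊥-elim (¬tilted (u , λ s → w∉A (s w∈)))

-- The instance on the oriented cycles

module Colouring {n : ℕ} {G : Graph n} (reg : Regular 3 G) (π : Edge G → Fin 3) (matching : IsMatchingPart π)
  (cycles : IsEvenCyclesPart π) (stars : IsIndepDoubleStarsPart π)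
  (L : Edge G → Fin 7 → ℕ) (L-inj : ∀ e → Injective _≡_ _≡_ (L e)) where

  open Decomposition reg π matching stars L L-inj

  r : ℕ
  r = proj₁ cycles

  abstract
    oriented : ∀ i → Oriented (proj₁ (proj₂ cycles) i)
    oriented i = orient (proj₁ (proj₂ cycles) i)

  C : Fin r → EvenCycle G
  C i = Oriented.C′ (oriented i)

  Index : Set
  Index = Σ (Fin r) (λ i → Fin (cycLen (half (C i))))

  at : Index → Fin n
  at (i , t) = vert (C i) t

  succ : Index → Index
  succ (i , t) = i , next (half (C i)) t

  pred : Index → Index
  pred (i , t) = i , prev (half (C i)) t

  succ-pred : ∀ a → succ (pred a) ≡ a
  succ-pred (i , t) = cong (i ,_) (next-prev (half (C i)) t)

  succ-injective : ∀ {a b} → succ a ≡ succ b → a ≡ b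
  succ-injective {i , t} {j , u} e with cong proj₁ e
  ... | refl = cong (i ,_) (next-injective (half (C i)) (vinj (C i) (cong at e)))

  succ-succ-≢ : ∀ a → succ (succ a) ≢ a
  succ-succ-≢ (i , t) e = next-next-≢ (half (C i)) t (vinj (C i) (cong at e))

  at-injective : ∀ {a b} → at a ≡ at b → a ≡ b
  at-injective {i , t} {j , u} e with i Finₚ.≟ j
  ... | yes refl = cong (i ,_) (vinj (C i) e)
  ... | no i≢j = let t₀ , p = Oriented.same (oriented i) t ; u₀ , q = Oriented.same (oriented j) u in
        ⊥-elim (proj₁ (proj₂ (proj₂ cycles)) i j t₀ u₀ i≢j (trans (≡-sym p) (trans e q)))

  E : Index → Edge G
  E (i , t) = proj₁ (cycleEdge (C i) t)

  E-joins : ∀ a → Joins (E a) (at a) (at (succ a))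
  E-joins (i , t) = proj₂ (cycleEdge (C i) t)

  E-joins-pred : ∀ a → Joins (E (pred a)) (at a) (at (pred a))
  E-joins-pred a = subst (λ b → Joins (E (pred a)) (at b) (at (pred a))) (succ-pred a)
                     (joins-sym (E (pred a)) (E-joins (pred a)))

  E-pred-≢ : ∀ a → E a ≢ E (pred a)
  E-pred-≢ a e = succ-succ-≢ a (trans (cong succ (at-injective {succ a} {pred a}
    (joins-end (E a) (E-joins a) (subst (λ f → Joins f (at a) (at (pred a))) (≡-sym e) (E-joins-pred a))))) (succ-pred a))

  E-part : ∀ a → π (E a) ≡ part1
  E-part (i , t) = proj₂ (proj₂ (proj₂ (proj₂ cycles))) (E (i , t)) i
                     (Oriented.off (oriented i) (E (i , t)) (t , E-joins (i , t)))

  E-covers : ∀ e → π e ≡ part1 → ∃[ a ] e ≡ E a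
  E-covers e p with proj₁ (proj₂ (proj₂ (proj₂ cycles))) e p
  ... | i , o with Oriented.on (oriented i) e o
  ...   | t , j = (i , t) , joins-unique j (E-joins (i , t))

  OnC : Fin n → Set
  OnC v = ∃[ a ] v ≡ at a

  part1-on : ∀ {e v w} → Joins e v w → π e ≡ part1 → OnC v
  part1-on {e} j p with E-covers e p
  ... | a , refl with joins-match (E a) j (E-joins a)
  ...   | inj₁ (q , _) = a , q
  ...   | inj₂ (q , _) = succ a , q

  -- The two edges at a leaf besides its star edge are not both in the matching.
  leaf-on : ∀ i k → OnC (lf i k)
  leaf-on i k with another reg (lf i k) (dv (D i) (centre k) ∷ []) (s≤s (s≤s z≤n))
  ... | e , w , j , w∉ with another reg (lf i k) (dv (D i) (centre k) ∷ w ∷ []) (s≤s (s≤s (s≤s z≤n)))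
  ...   | e′ , w′ , j′ , w′∉ = go (side e w j (w∉ ∘ here)) (side e′ w′ j′ (w′∉ ∘ here))
    where
    side : ∀ f u → Joins f (lf i k) u → u ≢ dv (D i) (centre k) → π f ≡ #0 ⊎ OnC (lf i k)
    side f u jf u≢ with π f in q
    ... | #0 = inj₁ refl
    ... | fs #0 = inj₂ (part1-on {f} jf q)
    ... | fs (fs #0) with leaf-part2 jf q
    ...   | refl = ⊥-elim (u≢ (joins-end f jf (proj₁ (proj₂ (leafEdge i k)))))
    go : π e ≡ #0 ⊎ OnC (lf i k) → π e′ ≡ #0 ⊎ OnC (lf i k) → OnC (lf i k)
    go (inj₂ o) _ = o
    go (inj₁ _) (inj₂ o) = o
    go (inj₁ p) (inj₁ p′) = ⊥-elim (matching e e′ p p′ (at-incident j j′ e≢e′))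
      where
      e≢e′ : e ≢ e′
      e≢e′ refl = w′∉ (there (here (joins-end e j′ j)))

  -- A matching edge, the star edge and two cycle edges would be four edges at one vertex.
  leaf-unmatched : ∀ i k p → ¬ Matched (lf i k) p
  leaf-unmatched i k p (e , j , q) with leaf-on i k
  ... | a , on = no-four-edges reg e f (E a) (E (pred a)) (subst (λ v → Joins e v p) on j)
      (subst (λ v → Joins f v (dv (D i) (centre k))) on jf) (E-joins a) (E-joins-pred a)
      ((parts-≢ q pf (λ ()) ∷ parts-≢ q (E-part a) (λ ()) ∷ parts-≢ q (E-part (pred a)) (λ ()) ∷ []) ∷
       (parts-≢ pf (E-part a) (λ ()) ∷ parts-≢ pf (E-part (pred a)) (λ ()) ∷ []) ∷ (E-pred-≢ a ∷ []) ∷ [] ∷ [])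
    where
    f : Edge G
    f = proj₁ (leafEdge i k)
    jf : Joins f (lf i k) (dv (D i) (centre k))
    jf = proj₁ (proj₂ (leafEdge i k))
    pf : π f ≡ part2
    pf = proj₂ (proj₂ (leafEdge i k))

  class-leaf : ∀ i k → kind (lf i k) ≡ pend i k × Lv (lf i k) ≡ lst (proj₁ (leafEdge i k))
  class-leaf i k with classify (lf i k)
  ... | matched p m = ⊥-elim (leaf-unmatched i k p m)
  ... | bare _ ¬l = ⊥-elim (¬l i k refl)
  ... | leafy _ j l e with dv-injective e
  ...   | refl , refl = refl , refl

  abstract
    on? : ∀ v → Dec (OnC v)
    on? v = map′ (λ (i , t , e) → (i , t) , e) (λ ((i , t) , e) → i , t , e)
              (Finₚ.any? (λ i → Finₚ.any? (λ t → v Finₚ.≟ vert (C i) t)))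

  module _ {v : Fin n} where
    nxtOf : Dec (OnC v) → Fin n
    nxtOf (yes (a , _)) = at (succ a)
    nxtOf (no _) = v

    listAt : Dec (OnC v) → List ℕ
    listAt (yes (a , _)) = lst (E a)
    listAt (no _) = Lv v

    parityOf : Dec (OnC v) → Bool
    parityOf (yes ((_ , t) , _)) = isOdd (toℕ t)
    parityOf (no _) = false

  nxt : Fin n → Fin n
  nxt v = nxtOf (on? v)

  Av : Fin n → List ℕ
  Av v = listAt (on? v)

  par : Fin n → Bool
  par v = parityOf (on? v)

  nxt-at : ∀ a → nxt (at a) ≡ at (succ a)
  nxt-at a = go (on? (at a))
    where
    go : (d : Dec (OnC (at a))) → nxtOf d ≡ at (succ a)
    go (yes (b , e)) = cong (at ∘ succ) (≡-sym (at-injective {a} {b} e))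
    go (no ¬o) = ⊥-elim (¬o (a , refl))

  Av-at : ∀ a → Av (at a) ≡ lst (E a)
  Av-at a = go (on? (at a))
    where
    go : (d : Dec (OnC (at a))) → listAt d ≡ lst (E a)
    go (yes (b , e)) = cong (lst ∘ E) (≡-sym (at-injective {a} {b} e))
    go (no ¬o) = ⊥-elim (¬o (a , refl))

  parity : Index → Bool
  parity (_ , t) = isOdd (toℕ t)

  par-at : ∀ a → par (at a) ≡ parity a
  par-at a = go (on? (at a))
    where
    go : (d : Dec (OnC (at a))) → parityOf d ≡ parity a
    go (yes (b , e)) = cong parity (≡-sym (at-injective {a} {b} e))
    go (no ¬o) = ⊥-elim (¬o (a , refl))

  par-nxt : ∀ a → par (nxt (at a)) ≡ not (par (at a))
  par-nxt a@(i , t) = trans (cong par (nxt-at a)) (trans (par-at (succ a))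
    (trans (isOdd-next (half (C i)) t) (cong not (≡-sym (par-at a)))))

  Av-7 : ∀ v → Seven (Av v)
  Av-7 v = go (on? v)
    where
    go : (d : Dec (OnC v)) → Seven (listAt d)
    go (yes (a , _)) = lst-7 (E a)
    go (no _) = listOf-7 (classify v)

  -- A leaf lies on a cycle and is adjacent to its successor there, while leaves are pairwise
  -- nonadjacent.
  indep : ∀ {v i k} → kind v ≡ pend i k → ∃[ p ] kind (nxt v) ≡ mat p
  indep {v} {i} {k} kd with lf-kind kd
  ... | refl with leaf-on i k
  ...   | a , on = go (kind (nxt v)) refl
    where
    adjacent : T (adj G (lf i k) (nxt (lf i k)))
    adjacent = subst (λ u → T (adj G u (nxt u))) (≡-sym on)
                 (subst (λ u → T (adj G (at a) u)) (≡-sym (nxt-at a)) (joins-adj (E a) (E-joins a)))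
    go : ∀ κ → kind (nxt (lf i k)) ≡ κ → ∃[ p ] kind (nxt (lf i k)) ≡ mat p
    go (mat p) kd′ = p , kd′
    go (pend j l) kd′ = ⊥-elim (leaves-apart i j k l (subst (λ u → T (adj G (lf i k) u)) (lf-kind kd′) adjacent))

  -- Closure under `nxt` spreads `Z` over the whole cycle, so the cycle is not tilted and its
  -- orientation makes it flat. Off the cycles `Av v` and `Lv (nxt v)` are the same list.
  flat : ∀ (Z : Fin n → Set) → (∀ v → Z v → Z (nxt v) × Lv v ⊆ Av v) → ∀ v → Z v → Av v ⊆ Lv (nxt v)
  flat Z closed v z = go (on? v)
    where
    shaped : ∀ i t → Z (at (i , t)) → Tilted (C i) ⊎ Flat (C i) → lst (E (i , t)) ⊆ Lv (at (succ (i , t)))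
    shaped i t z (inj₂ f) = f t
    shaped i t z (inj₁ (t₀ , ¬sub)) =
      ⊥-elim (¬sub (subst (Lv (at (i , t₀)) ⊆_) (Av-at (i , t₀)) (proj₂ (closed (at (i , t₀)) z₀))))
      where
      z₀ : Z (at (i , t₀))
      z₀ = next-reaches (half (C i)) (λ u → Z (at (i , u)))
             (λ u zu → subst Z (nxt-at (i , u)) (proj₁ (closed (at (i , u)) zu))) t t₀ z
    go : (d : Dec (OnC v)) → listAt d ⊆ Lv (nxtOf d)
    go (no _) = λ z∈ → z∈
    go (yes ((i , t) , e)) = shaped i t (subst Z e z) (Oriented.shape (oriented i))

  inst : Instance n s
  inst = record
    { nxt = nxt ; kind = kind ; lf = lf ; Lv = Lv ; Av = Av ; Kc = λ i → lst (proj₁ (starEdge i #0))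
    ; Lv-7 = λ v → listOf-7 (classify v) ; Av-7 = Av-7 ; Kc-7 = λ i → lst-7 _
    ; kind-lf = λ i k → proj₁ (class-leaf i k) ; lf-kind = lf-kind ; partner = partner ; indep = indep ; flat = flat }

  abstract
    sol : Solution inst
    sol = solve inst

  open Solution sol

  -- Colours left for the cycle edges

  pairList : ℕ × ℕ → List ℕ
  pairList (a , b) = a ∷ b ∷ []

  ∈-pairList : ∀ {z} p → z ∈₂ p → z ∈ pairList p
  ∈-pairList p (inj₁ e) = here e
  ∈-pairList p (inj₂ e) = there (here e)

  -- The empty list off the cycles spares the fixed points of `nxt`, where no parity can alternate.
  remaining : ∀ {v} → Dec (OnC v) → List ℕ
  remaining {v} (yes _) = Av v ∖ (pairList (P v) ++ pairList (P (nxt v)))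
  remaining (no _) = []

  R : Fin n → List ℕ
  R v = remaining (on? v)

  R-at : ∀ a → R (at a) ≡ Av (at a) ∖ (pairList (P (at a)) ++ pairList (P (nxt (at a))))
  R-at a = go (on? (at a))
    where
    go : (d : Dec (OnC (at a))) → remaining d ≡ Av (at a) ∖ (pairList (P (at a)) ++ pairList (P (nxt (at a))))
    go (yes _) = refl
    go (no ¬o) = ⊥-elim (¬o (a , refl))

  R-flip : ∀ v {z} → z ∈ R v → par (nxt v) ≡ not (par v)
  R-flip v z∈ = go (on? v) z∈
    where
    go : ∀ (d : Dec (OnC v)) {z} → z ∈ remaining d → par (nxt v) ≡ not (par v)
    go (yes (a , refl)) _ = par-nxt a

  R-unique : ∀ a → Unique (R (at a))
  R-unique a = subst Unique (≡-sym (R-at a)) (∖-unique (proj₁ (Av-7 (at a))))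

  other : ∀ {z} p → z ∈₂ p → ∃[ o ] (∀ {w} → w ∈ pairList p → w ≡ z ⊎ w ≡ o)
  other (a , b) (inj₁ refl) = b , λ { (here e) → inj₁ e ; (there (here e)) → inj₂ e }
  other (a , b) (inj₂ refl) = a , λ { (here e) → inj₂ e ; (there (here e)) → inj₁ e }

  -- The colour supplied by `keeps` is dropped from one of the pairs, because it is outside `Av v`
  -- or still listed in the other pair.
  three-lost : ∀ v → ∃[ zs ] (length zs ≡ 3 ×
               (∀ {z} → z ∈ Av v → z ∈ pairList (P v) ++ pairList (P (nxt v)) → z ∈ zs))
  three-lost v = go (keeps v)
    where
    A = Av v
    p = P v
    q = P (nxt v)
    Lost = ∃[ zs ] (length zs ≡ 3 × (∀ {z} → z ∈ A → z ∈ pairList p ++ pairList q → z ∈ zs))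
    go : ∃[ x ] (x ∈₂ p × (x ∉ A ⊎ x ∈₂ q)) ⊎ ∃[ x ] (x ∈₂ q × x ∉ A) → Lost
    go (inj₁ (x , x∈ , inj₁ x∉)) = let o , cov = other p x∈ in o ∷ pairList q , refl , λ z∈A z∈ → pick′ o cov z∈A (∈-++⁻ (pairList p) z∈)
      where
      pick′ : ∀ o → (∀ {w} → w ∈ pairList p → w ≡ x ⊎ w ≡ o) → ∀ {z} → z ∈ A → z ∈ pairList p ⊎ z ∈ pairList q → z ∈ o ∷ pairList q
      pick′ o cov z∈A (inj₂ z∈q) = there z∈q
      pick′ o cov z∈A (inj₁ z∈p) with cov z∈p
      ... | inj₁ refl = ⊥-elim (x∉ z∈A)
      ... | inj₂ e = here e
    go (inj₁ (x , x∈ , inj₂ x∈q)) = let o , cov = other q x∈q in o ∷ pairList p , refl , λ _ z∈ → pick′ o cov (∈-++⁻ (pairList p) z∈)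
      where
      pick′ : ∀ o → (∀ {w} → w ∈ pairList q → w ≡ x ⊎ w ≡ o) → ∀ {z} → z ∈ pairList p ⊎ z ∈ pairList q → z ∈ o ∷ pairList p
      pick′ o cov (inj₁ z∈p) = there z∈p
      pick′ o cov (inj₂ z∈q) with cov z∈q
      ... | inj₁ refl = there (∈-pairList p x∈)
      ... | inj₂ e = here e
    go (inj₂ (x , x∈q , x∉)) = let o , cov = other q x∈q in o ∷ pairList p , refl , λ z∈A z∈ → pick′ o cov z∈A (∈-++⁻ (pairList p) z∈)
      where
      pick′ : ∀ o → (∀ {w} → w ∈ pairList q → w ≡ x ⊎ w ≡ o) → ∀ {z} → z ∈ A → z ∈ pairList p ⊎ z ∈ pairList q → z ∈ o ∷ pairList p
      pick′ o cov z∈A (inj₁ z∈p) = there z∈p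
      pick′ o cov z∈A (inj₂ z∈q) with cov z∈q
      ... | inj₁ refl = ⊥-elim (x∉ z∈A)
      ... | inj₂ e = here e

  -- Seven colours less the three lost ones.
  R-length : ∀ a → 4 ≤ length (R (at a))
  R-length a = let zs , l , cov = three-lost (at a) in subst (λ xs → 4 ≤ length xs) (≡-sym (R-at a))
    (ℕₚ.+-cancelʳ-≤ 3 4 _ (≤-trans (≤-reflexive (≡-sym (proj₂ (Av-7 (at a)))))
      (subst (λ m → length (Av (at a)) ≤ length (Av (at a) ∖ (pairList (P (at a)) ++ pairList (P (nxt (at a))))) + m) l
        (∖-length {zs = zs} (proj₁ (Av-7 (at a))) cov))))

  abstract
    chosen : CyclePairs nxt R
    chosen = cycle-pairs nxt par R R-flip

  module Chosen = CyclePairs chosen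

  -- Pairs on all edges and their disjointness

  onCycle : Index → List ℕ
  onCycle a = Chosen.taken (at a)

  onCycle-R : ∀ a {z} → z ∈ onCycle a → z ∈ Av (at a) × z ∉ pairList (P (at a)) ++ pairList (P (nxt (at a)))
  onCycle-R a {z} z∈ = ∈-∖⁻ (subst (z ∈_) (R-at a) (Chosen.sound (at a) z∈))

  onCycle-succ : ∀ a {z} → z ∈ onCycle a → z ∉ onCycle (succ a)
  onCycle-succ a {z} z∈ z∈′ = Chosen.apart (at a) z∈
    (subst (λ v → z ∈ Chosen.taken v) (≡-sym (nxt-at a)) z∈′)

  as-pair : ∀ xs → length xs ≡ 2 → Unique xs → ∃[ p ] ((∀ {z} → z ∈₂ p → z ∈ xs) × proj₁ p ≢ proj₂ p)
  as-pair (a ∷ b ∷ []) _ ((a≢b ∷ _) ∷ _) = (a , b) , (λ { (inj₁ e) → here e ; (inj₂ e) → there (here e) }) , a≢b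

  cyclePair : ∀ a → ∃[ p ] ((∀ {z} → z ∈₂ p → z ∈ onCycle a) × proj₁ p ≢ proj₂ p)
  cyclePair a = as-pair (onCycle a) (Chosen.full (at a) (R-unique a) (R-length a)) (Chosen.unique (at a))

  -- The type of an edge with the origin of its pair. For a cycle edge inclusion in `onCycle`
  -- suffices, since disjointness passes to smaller sets.
  data Spec (e : Edge G) (p : ℕ × ℕ) : Set where
    isMatching : π e ≡ #0 → p ≡ P (x e) → Spec e p
    isCycle    : ∀ a → e ≡ E a → (∀ {z} → z ∈₂ p → z ∈ onCycle a) → Spec e p
    isCentral  : ∀ i → e ≡ proj₁ (starEdge i #0) → p ≡ Q i → Spec e p
    isLeaf     : ∀ i k → e ≡ proj₁ (leafEdge i k) → p ≡ P (lf i k) → Spec e p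

  assign : ∀ e → ∃[ p ] (PairFrom (lst e) p × Spec e p)
  assign e = go (π e) refl
    where
    star : ∃[ i ] OnDoubleStar (D i) e → ∃[ p ] (PairFrom (lst e) p × Spec e p)
    star (i , #0 , j) = Q i , subst (λ f → PairFrom (lst f) (Q i)) (≡-sym e≡) (Q-from i) , isCentral i e≡ refl
      where
      e≡ : e ≡ proj₁ (starEdge i #0)
      e≡ = joins-unique j (proj₁ (proj₂ (starEdge i #0)))
    star (i , fs k , j) = P (lf i k) , subst (λ l → PairFrom l (P (lf i k))) (trans (proj₂ (class-leaf i k)) (cong lst (≡-sym e≡)))
        (P-from (lf i k)) , isLeaf i k e≡ refl
      where
      e≡ : e ≡ proj₁ (leafEdge i k)
      e≡ = joins-unique (subst (λ q → Joins e (dv (D i) (proj₁ q)) (dv (D i) (proj₂ q))) (dsEdge-leaf k) j)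
             (joins-sym (proj₁ (leafEdge i k)) (proj₁ (proj₂ (leafEdge i k))))
    cyc : ∃[ a ] e ≡ E a → ∃[ p ] (PairFrom (lst e) p × Spec e p)
    cyc (a , e≡) = let p , p⊆ , d = cyclePair a in
      p , (inList (p⊆ (inj₁ refl)) , inList (p⊆ (inj₂ refl)) , d) , isCycle a e≡ p⊆
      where
      inList : ∀ {z} → z ∈ onCycle a → z ∈ lst e
      inList {z} z∈ = subst (z ∈_) (trans (Av-at a) (cong lst (≡-sym e≡))) (proj₁ (onCycle-R a z∈))
    go : ∀ c → π e ≡ c → ∃[ p ] (PairFrom (lst e) p × Spec e p)
    -- Either end could be used, as `P-mat` makes the pairs at the two ends agree.
    go #0 q = P (x e) , subst (λ l → PairFrom l (P (x e))) (proj₂ (class-matched (e , joins-self e , q))) (P-from (x e)) ,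
              isMatching q refl
    go (fs #0) q = cyc (E-covers e q)
    go (fs (fs #0)) q = star (D-covers e q)

  matching-end : ∀ {e v w z} → Joins e v w → π e ≡ #0 → z ∈₂ P (x e) → z ∈₂ P v
  matching-end {e} {z = z} j q z∈ with joins-match e j (joins-self e)
  ... | inj₁ (v≡ , _) = subst (λ u → z ∈₂ P u) (≡-sym v≡) z∈
  ... | inj₂ (v≡ , _) = subst (λ u → z ∈₂ P u) (≡-sym v≡) (P-mat (proj₁ (class-matched (e , joins-self e , q))) z∈)

  cycle-end : ∀ a {v w} → Joins (E a) v w → v ≡ at a ⊎ v ≡ at (succ a)
  cycle-end a j with joins-match (E a) j (E-joins a)
  ... | inj₁ (p , _) = inj₁ p
  ... | inj₂ (p , _) = inj₂ p

  onCycle-P : ∀ a {v w z} → Joins (E a) v w → z ∈ onCycle a → z ∈₂ P v → ⊥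
  onCycle-P a {v} {w} {z} j z∈ z∈P with cycle-end a j
  ... | inj₁ refl = proj₂ (onCycle-R a z∈) (∈-++⁺ˡ (∈-pairList (P (at a)) z∈P))
  ... | inj₂ refl = proj₂ (onCycle-R a z∈) (∈-++⁺ʳ (pairList (P (at a)))
        (∈-pairList (P (nxt (at a))) (subst (λ u → z ∈₂ P u) (≡-sym (nxt-at a)) z∈P)))

  central-end : ∀ i {v w} → Joins (proj₁ (starEdge i #0)) v w → ∃[ c ] (Centre c × v ≡ dv (D i) c)
  central-end i j with joins-match (proj₁ (starEdge i #0)) j (proj₁ (proj₂ (starEdge i #0)))
  ... | inj₁ (p , _) = #0 , first , p
  ... | inj₂ (p , _) = fs #0 , second , p

  leaf-end : ∀ i k {v w} → Joins (proj₁ (leafEdge i k)) v w → v ≡ lf i k ⊎ v ≡ dv (D i) (centre k)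
  leaf-end i k j with joins-match (proj₁ (leafEdge i k)) j (proj₁ (proj₂ (leafEdge i k)))
  ... | inj₁ (p , _) = inj₁ p
  ... | inj₂ (p , _) = inj₂ p

  leaf-not-centre : ∀ {k c} → Centre c → leaf k ≢ c
  leaf-not-centre first ()
  leaf-not-centre second ()

  at-centre : ∀ {e i c v w} → Centre c → v ≡ dv (D i) c → Joins e v w → π e ≢ part2 → ⊥
  at-centre c refl j = centre-full c j

  matching-≢2 : ∀ {e} → π e ≡ #0 → π e ≢ part2
  matching-≢2 p q with trans (≡-sym p) q
  ... | ()

  cycle-≢2 : ∀ a → π (E a) ≢ part2
  cycle-≢2 a q with trans (≡-sym (E-part a)) q
  ... | ()

  module _ {e f : Edge G} {v a b : Fin n} (e≢f : e ≢ f) (je : Joins e v a) (jf : Joins f v b) where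

    matching-cycle : ∀ c → π e ≡ #0 → f ≡ E c → ∀ {z} → z ∈₂ P (x e) → z ∈ onCycle c → ⊥
    matching-cycle c p refl z∈ z∈′ = onCycle-P c jf z∈′ (matching-end {e} je p z∈)

    matching-leaf : ∀ i k → π e ≡ #0 → f ≡ proj₁ (leafEdge i k) → ⊥
    matching-leaf i k p refl with leaf-end i k jf
    ... | inj₁ refl = leaf-unmatched i k a (e , je , p)
    ... | inj₂ q = at-centre {e} (centre-Centre k) q je (matching-≢2 {e} p)

    matching-central : ∀ i → π e ≡ #0 → f ≡ proj₁ (starEdge i #0) → ⊥
    matching-central i p refl = let c , ctr , q = central-end i jf in at-centre {e} ctr q je (matching-≢2 {e} p)

    -- Cycle edges with the same tail or the same head coincide; otherwise one follows the other and
    -- `onCycle-succ` applies.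
    cycle-cycle : ∀ c d → e ≡ E c → f ≡ E d → ∀ {z} → z ∈ onCycle c → z ∈ onCycle d → ⊥
    cycle-cycle c d refl refl {z} z∈ z∈′ with cycle-end c je | cycle-end d jf
    ... | inj₁ p | inj₁ q = e≢f (cong E (at-injective {c} {d} (trans (≡-sym p) q)))
    ... | inj₂ p | inj₂ q = e≢f (cong E (succ-injective {c} {d} (at-injective {succ c} {succ d} (trans (≡-sym p) q))))
    ... | inj₂ p | inj₁ q = onCycle-succ c z∈ (subst (λ u → z ∈ onCycle u) (at-injective {d} {succ c} (trans (≡-sym q) p)) z∈′)
    ... | inj₁ p | inj₂ q = onCycle-succ d z∈′ (subst (λ u → z ∈ onCycle u) (at-injective {c} {succ d} (trans (≡-sym p) q)) z∈)

    cycle-central : ∀ c i → e ≡ E c → f ≡ proj₁ (starEdge i #0) → ⊥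
    cycle-central c i refl refl = let _ , ctr , q = central-end i jf in at-centre {E c} ctr q je (cycle-≢2 c)

    cycle-leaf : ∀ c i k → e ≡ E c → f ≡ proj₁ (leafEdge i k) → ∀ {z} → z ∈ onCycle c → z ∈₂ P (lf i k) → ⊥
    cycle-leaf c i k refl refl z∈ z∈′ with leaf-end i k jf
    ... | inj₁ refl = onCycle-P c je z∈ z∈′
    ... | inj₂ q = at-centre {E c} (centre-Centre k) q je (cycle-≢2 c)

    central-central : ∀ i j → e ≡ proj₁ (starEdge i #0) → f ≡ proj₁ (starEdge j #0) → ⊥
    central-central i j refl refl with central-end i je | central-end j jf
    ... | _ , _ , p | _ , _ , q with dv-injective (trans (≡-sym p) q)
    ...   | refl , _ = e≢f refl

    central-leaf : ∀ i j k → e ≡ proj₁ (starEdge i #0) → f ≡ proj₁ (leafEdge j k) → ∀ {z} → z ∈₂ Q i → z ∈₂ P (lf j k) → ⊥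
    central-leaf i j k refl refl with central-end i je | leaf-end j k jf
    ... | _ , _ , p | inj₁ q with dv-injective (trans (≡-sym p) q)
    ...   | refl , _ = P-Q i k
    central-leaf i j k refl refl | _ , _ , p | inj₂ q with dv-injective (trans (≡-sym p) q)
    ...   | refl , _ = P-Q i k

    -- Distinct leaf edges cannot meet in a leaf, and those meeting in a centre belong to siblings.
    leaf-leaf : ∀ i k j l → e ≡ proj₁ (leafEdge i k) → f ≡ proj₁ (leafEdge j l) →
                ∀ {z} → z ∈₂ P (lf i k) → z ∈₂ P (lf j l) → ⊥
    leaf-leaf i k j l refl refl with leaf-end i k je | leaf-end j l jf
    ... | inj₁ p | inj₁ q with dv-injective (trans (≡-sym p) q)
    ...   | refl , refl = ⊥-elim (e≢f refl)
    leaf-leaf i k j l refl refl | inj₁ p | inj₂ q =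
      ⊥-elim (leaf-not-centre (centre-Centre l) (proj₂ (dv-injective (trans (≡-sym p) q))))
    leaf-leaf i k j l refl refl | inj₂ p | inj₁ q =
      ⊥-elim (leaf-not-centre (centre-Centre k) (proj₂ (dv-injective (trans (≡-sym q) p))))
    leaf-leaf i k j l refl refl | inj₂ p | inj₂ q with dv-injective (trans (≡-sym p) q)
    ... | refl , c with same-centre k l c
    ...   | inj₁ refl = ⊥-elim (e≢f refl)
    ...   | inj₂ refl = P-sib i k

  separated : ∀ {e f p q v a b} → e ≢ f → Joins e v a → Joins f v b → Spec e p → Spec f q → Disjoint₂ p q
  separated {e} {f} e≢f je jf = go
    where
    f≢e : f ≢ e
    f≢e r = e≢f (≡-sym r)
    go : ∀ {p q} → Spec e p → Spec f q → Disjoint₂ p q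
    go (isMatching p _) (isMatching q _) _ _ = matching e f p q (at-incident {e = e} {f} je jf e≢f)
    go (isMatching p refl) (isCycle c r s) z∈ z∈′ = matching-cycle e≢f je jf c p r z∈ (s z∈′)
    go (isMatching p _) (isCentral i r _) _ _ = matching-central e≢f je jf i p r
    go (isMatching p _) (isLeaf i k r _) _ _ = matching-leaf e≢f je jf i k p r
    go (isCycle c r s) (isMatching p refl) z∈ z∈′ = matching-cycle f≢e jf je c p r z∈′ (s z∈)
    go (isCycle c r s) (isCycle d r′ s′) z∈ z∈′ = cycle-cycle e≢f je jf c d r r′ (s z∈) (s′ z∈′)
    go (isCycle c r _) (isCentral i r′ _) _ _ = cycle-central e≢f je jf c i r r′
    go (isCycle c r s) (isLeaf i k r′ refl) z∈ z∈′ = cycle-leaf e≢f je jf c i k r r′ (s z∈) z∈′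
    go (isCentral i r _) (isMatching p _) _ _ = matching-central f≢e jf je i p r
    go (isCentral i r _) (isCycle c r′ _) _ _ = cycle-central f≢e jf je c i r′ r
    go (isCentral i r _) (isCentral j r′ _) _ _ = central-central e≢f je jf i j r r′
    go (isCentral i r refl) (isLeaf j k r′ refl) = central-leaf e≢f je jf i j k r r′
    go (isLeaf i k r _) (isMatching p _) _ _ = matching-leaf f≢e jf je i k p r
    go (isLeaf i k r refl) (isCycle c r′ s) z∈ z∈′ = cycle-leaf f≢e jf je c i k r′ r (s z∈′) z∈
    go (isLeaf i k r refl) (isCentral j r′ refl) z∈ z∈′ = central-leaf f≢e jf je j i k r′ r z∈′ z∈
    go (isLeaf i k r refl) (isLeaf j l r′ refl) = leaf-leaf e≢f je jf i k j l r r′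

  component : ℕ × ℕ → Fin 2 → ℕ
  component p #0 = proj₁ p
  component p (fs #0) = proj₂ p

  component-∈₂ : ∀ p j → component p j ∈₂ p
  component-∈₂ p #0 = inj₁ refl
  component-∈₂ p (fs #0) = inj₂ refl

  result : Σ (Edge G → Fin 2 → ℕ) λ c → (∀ e → Injective _≡_ _≡_ (c e)) × (∀ e j → ∃[ i ] c e j ≡ L e i) ×
           (∀ e f → Incident e f → ∀ j k → c e j ≢ c f k)
  result = (λ e → component (proj₁ (assign e))) , injective , fromList , proper
    where
    injective : ∀ e → Injective _≡_ _≡_ (component (proj₁ (assign e)))
    injective e {#0} {#0} _ = refl
    injective e {fs #0} {fs #0} _ = refl
    injective e {#0} {fs #0} q = ⊥-elim (proj₂ (proj₂ (proj₁ (proj₂ (assign e)))) q)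
    injective e {fs #0} {#0} q = ⊥-elim (proj₂ (proj₂ (proj₁ (proj₂ (assign e)))) (≡-sym q))
    fromList : ∀ e j → ∃[ i ] component (proj₁ (assign e)) j ≡ L e i
    fromList e #0 = ∈-tabulate⁻ (proj₁ (proj₁ (proj₂ (assign e))))
    fromList e (fs #0) = ∈-tabulate⁻ (proj₁ (proj₂ (proj₁ (proj₂ (assign e)))))
    proper : ∀ e f → Incident e f → ∀ j k → component (proj₁ (assign e)) j ≢ component (proj₁ (assign f)) k
    proper e f inc j k q = let e≢f , v , a , b , je , jf = incident-at {e = e} {f} inc in
      separated e≢f je jf (proj₂ (proj₂ (assign e))) (proj₂ (proj₂ (assign f)))
        (component-∈₂ (proj₁ (assign e)) j)
        (subst (_∈₂ proj₁ (assign f)) (≡-sym q) (component-∈₂ (proj₁ (assign f)) k))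

theorem2 : {n : ℕ} (G : Graph n) → Regular 3 G → HasMEDDecomposition G →
    EdgeChoosable 7 2 G
theorem2 G reg (π , matching , cycles , stars) L L-inj = Colouring.result reg π matching cycles stars L L-inj
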